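{- Let $p$ be a prime with $p\equiv 1\pmod 4$ and let $s$ be a positive integer. If $\bar a_s(6p)\equiv 0\pmod 2$, then for all integers $n,k\ge 0$ with $p\nmid(4n+3)$, $$\bar a_s\left(8p^{4k+1}n+6p^{4k+1}\right)\equiv 0\pmod{16}.$$
   Context: For integers $\ell\ge1$ write $f_\ell=\prod_{j\ge 1}(1-q^{\ell j})$. For a positive integer $s$, $\bar a_s(n)$ denotes the number of partitions of $n$ in which each odd part occurs in one of $s$ colors and the first occurrence of each part (parts of the same size but different colors being distinct) may be overlined. Equivalently, $$\sum_{n\ge0}\bar a_s(n)q^n=\frac{f_2^{3s-2}}{f_1^{2s}f_4^{s-1}}.$$ -}

module Defs where

open import Data.Bool.Base using (Bool; true; false)
open import Data.Fin.Base using (Fin)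
open import Data.List.Base using (List; []; _∷_; _++_; map; concatMap; cartesianProductWith; filter; length; replicate; upTo; allFin)
open import Data.Nat.Base using (ℕ; suc; parity)
open import Data.Nat.ListAction using (sum)
open import Data.Nat.Properties using (_≟_)
open import Data.Parity.Base using (Parity; 0ℙ; 1ℙ)
open import Data.Product.Base using (Σ; _,_)

-- Number of colours available to parts of size j: s for odd j; even parts
-- are uncoloured, i.e. have a single colour.
colours : ℕ → ℕ → ℕ
colours s j = byParity (parity j)
  where
  byParity : Parity → ℕ
  byParity 0ℙ = 1
  byParity 1ℙ = s

-- Parts of equal size but different colours are distinct, so "the first
-- occurrence of each part" refers to each pair (size , colour).
ColouredPart : ℕ → Set
ColouredPart s = Σ ℕ λ j → Fin (colours s j)

record Occurrence (s : ℕ) : Set where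
  constructor occurrence
  field
    size      : ℕ
    colour    : Fin (colours s size)
    overlined : Bool

open Occurrence public

occ : ∀ {s} → Bool → ColouredPart s → Occurrence s
occ o (j , c) = occurrence j c o

colouredParts : ∀ s → ℕ → List (ColouredPart s)
colouredParts s N =
  concatMap (λ i → map (suc i ,_) (allFin (colours s (suc i)))) (upTo N)

-- The ways in which one coloured part can occur, with multiplicity at most N:
-- not at all, or 1 + m times with the first occurrence overlined or not.
blocks : ∀ {s} → ℕ → ColouredPart s → List (List (Occurrence s))
blocks N κ = [] ∷ concatMap present (upTo N)
  where
  present : ℕ → List (List (Occurrence _))
  present m = (occ false κ ∷ replicate m (occ false κ))
            ∷ (occ true  κ ∷ replicate m (occ false κ))
            ∷ []

arrangements : ∀ {s} → ℕ → List (ColouredPart s) → List (List (Occurrence s))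
arrangements N []       = [] ∷ []
arrangements N (κ ∷ κs) = cartesianProductWith _++_ (blocks N κ) (arrangements N κs)

-- The partitions of n, each listed exactly once as a sequence of parts grouped
-- by size and colour. Bounding sizes and multiplicities by n loses nothing,
-- since all parts are positive and sum to n.
overpartitions : ∀ s → ℕ → List (List (Occurrence s))
overpartitions s n =
  filter (λ π → sum (map size π) ≟ n) (arrangements n (colouredParts s n))

-- Generating function: f₂^(3s-2) / (f₁^(2s) f₄^(s-1)).  A coloured part of size
-- j contributes (1 + q^j) / (1 - q^j), and the odd j are used s times each.
ā : ℕ → ℕ → ℕ
ā s n = length (overpartitions s n)

{-# OPTIONS --safe #-}
-- Write G for the generating function of ā s and φ(q) = 1 + 2 Σ (-1)^j q^(j²).
-- Gauss's identity gives G = φ(q)^(-s) φ(q²)^(s-1); it is used in a finite form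
-- (in the style of Shanks), which holds in ℤ[[q]]/(q^(N+1)) up to terms that vanish.
-- Since φ^8 ≡ 1 modulo 16, G ≡ φ(q)^(7s) φ(q²)^(s-1), and the expansion in powers
-- of 2 stops after the cubic terms. With A = Σ (-1)^j q^(j²), B = A(q²), C = A(q⁴) and
-- A² ≡ B, B² ≡ C modulo 2, every coefficient at N = 2M, M ≡ 3 (mod 4), vanishes for
-- reasons modulo 8 except those of AB and BC, which count representations
-- M = x² + 2y²; as s (s - 1) is even, it suffices that this number is even.
--
-- If M ≡ 7 (mod 8) there are none. If M ≡ 3 (mod 8), consider the solutions of
-- x² + 2yz = M: those fixed by exchanging y and z are the representations, and
-- Jackson's involution leaves only the solutions with x = y, that is, the
-- factorizations M = d d' with d < d'. Finally M = P m with P = p^(4k+1) and m coprime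
-- nonsquares, and exchanging the m-parts of d and d' has no fixed point.
module Submission where

open import Defs
open import Algebra.Bundles using (CommutativeRing; RawRing)
import Algebra.Properties.CommutativeSemiring.Exp as Exp
import Algebra.Solver.Ring as Solver
open import Algebra.Solver.Ring.AlmostCommutativeRing using (fromCommutativeRing; _-Raw-AlmostCommutative⟶_)
open import Data.Bool.Base using (true; false; if_then_else_; T)
open import Data.Fin.Base using (Fin; toℕ; fromℕ<)
open import Data.Fin.Properties using (all?; toℕ-fromℕ<)
open import Data.List.Base as List
  using (List; []; _∷_; _++_; allFin; cartesianProduct; cartesianProductWith; concatMap; downFrom; filter; length; map; replicate; upTo)
import Data.List.Properties as Listₚ
open import Data.List.Relation.Unary.All as All using (All; []; _∷_)
import Data.List.Relation.Unary.All.Properties as Allₚ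
open import Data.Maybe.Base using (Maybe; just; nothing)
open import Data.Nat.Base as ℕ using (ℕ; zero; suc; parity)
import Data.Nat.Divisibility as ℕ∣
open import Data.Nat.DivMod using (m≡m%n+[m/n]*n; m%n<n; [m+kn]%n≡m%n; %-distribˡ-*)
open import Data.Nat.ListAction using () renaming (sum to Σℕ)
open import Data.Nat.ListAction.Properties using (sum-++)
import Data.Nat.Properties as ℕₚ
import Data.Nat.Tactic.RingSolver as ℕ-Solver
open import Data.Parity.Base using (Parity; 0ℙ; 1ℙ)
open import Data.Product.Base using (∃; _×_; _,_; proj₁; proj₂)
open import Data.Sum.Base using (_⊎_; inj₁; inj₂)
open import Function.Base using (_∘_)
open import Level using (0ℓ)
import Relation.Binary.Reasoning.Setoid as SetoidReasoning
open import Relation.Binary.PropositionalEquality as ≡ using (_≡_; _≢_)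
open import Relation.Nullary using (Dec; yes; no; ¬_; contradiction)
open import Relation.Nullary.Decidable using (¬?; from-yes)

-- The number of representations x² + 2y² = M could be read off from unique factorization in ℤ[√-2];
-- the involutions replace this by elementary counting. What remains is that M = P m has a number of
-- divisors divisible by 4, the factorizations with d < d' being half as many. Here the hypotheses
-- on p enter: p ≡ 1 (mod 4) gives P ≡ 1 and hence M ≡ 3 (mod 4), the odd exponent makes P a
-- nonsquare, m = 4n + 3 is a nonsquare modulo 4, and p ∤ m makes P and m coprime. Both nonsquares
-- are needed because factorizations are unordered: a fixed point sends d to d, which makes m a
-- square, or d to d', which makes P a square.
--
-- Jackson's map is piecewise linear, and the boundaries between its pieces are the delicate points.
-- For M ≡ 3 (mod 8) all of x, y, z are odd, which excludes every boundary but x = y.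
--
-- Truncation makes q nilpotent: the factors 1 - q^j have finite geometric series as inverses, and
-- no limit is ever taken. Congruences modulo 2 and 16 are equations with an explicit multiple, so
-- that everything happens in one ring.

-- Binary quadratic forms modulo 8

module Residues where

  open ≡ using (refl; sym; trans; cong; cong₂)

  mod-8-residue : ∀ a b x y → (a ℕ.* (x ℕ.* x) ℕ.+ b ℕ.* (y ℕ.* y)) ℕ.% 8 ≡ (a ℕ.* (x ℕ.% 8 ℕ.* (x ℕ.% 8)) ℕ.+ b ℕ.* (y ℕ.% 8 ℕ.* (y ℕ.% 8))) ℕ.% 8
  mod-8-residue a b x y = trans (cong (ℕ._% 8) (trans (cong₂ (λ x y → a ℕ.* (x ℕ.* x) ℕ.+ b ℕ.* (y ℕ.* y)) (m≡m%n+[m/n]*n x 8) (m≡m%n+[m/n]*n y 8))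
                                              (expand a b (x ℕ.% 8) (x ℕ./ 8) (y ℕ.% 8) (y ℕ./ 8))))
                          ([m+kn]%n≡m%n (a ℕ.* (x ℕ.% 8 ℕ.* (x ℕ.% 8)) ℕ.+ b ℕ.* (y ℕ.% 8 ℕ.* (y ℕ.% 8)))
                            (a ℕ.* (2 ℕ.* (x ℕ.% 8) ℕ.* (x ℕ./ 8) ℕ.+ 8 ℕ.* (x ℕ./ 8 ℕ.* (x ℕ./ 8))) ℕ.+ b ℕ.* (2 ℕ.* (y ℕ.% 8) ℕ.* (y ℕ./ 8) ℕ.+ 8 ℕ.* (y ℕ./ 8 ℕ.* (y ℕ./ 8)))) 8)
    where
    expand : ∀ a b r u s v → a ℕ.* ((r ℕ.+ u ℕ.* 8) ℕ.* (r ℕ.+ u ℕ.* 8)) ℕ.+ b ℕ.* ((s ℕ.+ v ℕ.* 8) ℕ.* (s ℕ.+ v ℕ.* 8))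
      ≡ a ℕ.* (r ℕ.* r) ℕ.+ b ℕ.* (s ℕ.* s) ℕ.+ (a ℕ.* (2 ℕ.* r ℕ.* u ℕ.+ 8 ℕ.* (u ℕ.* u)) ℕ.+ b ℕ.* (2 ℕ.* s ℕ.* v ℕ.+ 8 ℕ.* (v ℕ.* v))) ℕ.* 8
    expand = ℕ-Solver.solve-∀

  module _ (a b c : ℕ) where

    -- All 64 pairs of residues are tested by evaluation, so that each obstruction costs one
    -- `from-yes`; `b = 0` covers forms in one variable.
    avoids? : Dec (∀ (i j : Fin 8) → (a ℕ.* (toℕ i ℕ.* toℕ i) ℕ.+ b ℕ.* (toℕ j ℕ.* toℕ j)) ℕ.% 8 ≢ c)
    avoids? = all? λ i → all? λ j → ¬? ((a ℕ.* (toℕ i ℕ.* toℕ i) ℕ.+ b ℕ.* (toℕ j ℕ.* toℕ j)) ℕ.% 8 ℕₚ.≟ c)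

    avoids⇒≢ : (∀ (i j : Fin 8) → (a ℕ.* (toℕ i ℕ.* toℕ i) ℕ.+ b ℕ.* (toℕ j ℕ.* toℕ j)) ℕ.% 8 ≢ c) →
      ∀ {n} → n ℕ.% 8 ≡ c → ∀ x y → a ℕ.* (x ℕ.* x) ℕ.+ b ℕ.* (y ℕ.* y) ≢ n
    avoids⇒≢ avoids n≡c x y eq = avoids (fromℕ< (m%n<n x 8)) (fromℕ< (m%n<n y 8))
      (trans (cong₂ (λ i j → (a ℕ.* (i ℕ.* i) ℕ.+ b ℕ.* (j ℕ.* j)) ℕ.% 8) (toℕ-fromℕ< (m%n<n x 8)) (toℕ-fromℕ< (m%n<n y 8)))
      (trans (sym (mod-8-residue a b x y)) (trans (cong (ℕ._% 8) eq) n≡c)))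

open Residues

module GeneratingFunction where

  open import Data.Integer.Base as ℤ using (ℤ; +_; -[1+_])
  open import Data.Integer.Divisibility.Signed as ℤ∣ using (divides)
  import Data.Integer.Properties as ℤₚ
  import Data.Integer.Tactic.RingSolver as ℤ-Solver

  -- Theta series in a commutative ring

  sg : ℕ → ℤ
  sg zero    = + 1
  sg (suc n) = ℤ.- sg n

  ℤ-rawRing : RawRing 0ℓ 0ℓ
  ℤ-rawRing = CommutativeRing.rawRing ℤₚ.+-*-commutativeRing

  -- In identities given to the solver, constants are written `K c`, even 0 and 1, because `RS`
  -- treats images of integers as coefficients; `K-0` and `K-1` translate to the units of the ring.
  module ThetaSeries (R : CommutativeRing 0ℓ 0ℓ)
                     (ι : ℤ-rawRing -Raw-AlmostCommutative⟶ fromCommutativeRing R) where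

    open CommutativeRing R
    open _-Raw-AlmostCommutative⟶_ ι public using ()
      renaming (⟦_⟧ to K; +-homo to K-+; *-homo to K-*; -‿homo to K-neg; 0-homo to K-0; 1-homo to K-1)
    open Exp commutativeSemiring public using (_^_; ^-homo-*; ^-assocʳ; ^-congˡ; ^-distrib-*)
    open SetoidReasoning setoid

    K-≟ : (a b : ℤ) → Maybe (K a ≈ K b)
    K-≟ a b with a ℤₚ.≟ b
    ... | yes a≡b = just (reflexive (≡.cong K a≡b))
    ... | no  _   = nothing

    module RS = Solver ℤ-rawRing (fromCommutativeRing R) ι K-≟
    open RS using (solve; _:=_; _:+_; _:*_; _:-_; :-_; con)

    ^-split : ∀ x {a} b c → a ≡ b ℕ.+ c → x ^ a ≈ x ^ b * x ^ c
    ^-split x b c ≡.refl = ^-homo-* x b c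

    sum : ∀ {A : Set} → (A → Carrier) → List A → Carrier
    sum f []       = 0#
    sum f (x ∷ xs) = f x + sum f xs

    -- The index j stands for the square of j + 1, so `θ q n` runs over the squares of 1, ..., n.
    -- With `downFrom` the newest term is at the head, and the step from n to `suc n` unfolds by
    -- computation.
    θ-term : Carrier → ℕ → Carrier
    θ-term q j = K (sg (suc j)) * q ^ (suc j ℕ.* suc j)

    θ : Carrier → ℕ → Carrier
    θ q n = sum (θ-term q) (downFrom n)

    φ : Carrier → ℕ → Carrier
    φ q n = K (+ 1) + K (+ 2) * θ q n

    -- Gauss's identity in finite form

    module Gauss (q : Carrier) where

      D : ℕ → Carrier
      D zero    = K (+ 1)
      D (suc n) = D n * (K (+ 1) + q ^ suc n)

      -- `Q 0 n` over `D n` is the partial product in Gauss's identity; other starting points occur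
      -- in the correction terms.
      Q : ℕ → ℕ → Carrier
      Q s zero    = K (+ 1)
      Q s (suc d) = Q s d * (K (+ 1) - q ^ suc (s ℕ.+ d))

      Q-left : ∀ s d → Q s (suc d) ≈ (K (+ 1) - q ^ suc s) * Q (suc s) d
      Q-left s zero rewrite ℕₚ.+-identityʳ s = *-comm _ _
      Q-left s (suc d) = begin
        Q s (suc d) * (K (+ 1) - q ^ suc (s ℕ.+ suc d))
          ≈⟨ *-cong (Q-left s d) (reflexive (≡.cong (λ i → K (+ 1) - q ^ suc i) (ℕₚ.+-suc s d))) ⟩
        (K (+ 1) - q ^ suc s) * Q (suc s) d * (K (+ 1) - q ^ suc (suc s ℕ.+ d))
          ≈⟨ *-assoc _ _ _ ⟩
        (K (+ 1) - q ^ suc s) * (Q (suc s) d * (K (+ 1) - q ^ suc (suc s ℕ.+ d))) ∎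

      -- S k d is the sum over 1 ≤ s ≤ k of (-1)^s 2 (Π_{s<j≤n} (1 - q^j)) (Π_{j<s} (1 + q^j)) q^(s(n+1)),
      -- where n = k + d. Passing from n to n + 1, it telescopes up to the factor 1 + q^(n+1).
      t : ℕ → ℕ → Carrier
      t k d = K (+ 2) * K (sg (suc k)) * Q (suc k) d * D k * q ^ (suc k ℕ.* suc (suc k ℕ.+ d))

      S : ℕ → ℕ → Carrier
      S zero    d = K (+ 0)
      S (suc k) d = S k (suc d) + t k d

      -- The boundary term of the telescoping. Its value at the other end, k = 0, is
      -- `Q 0 n * q ^ suc n` with n the sum of the two arguments.
      w : ℕ → ℕ → Carrier
      w k d = Q k d * D k * q ^ (suc k ℕ.* suc (k ℕ.+ d))

      S-suc : ∀ k d → S k (suc d) ≈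
        (K (+ 1) + q ^ suc (k ℕ.+ d)) * S k d + K (+ 2) * (Q 0 (k ℕ.+ d) * q ^ suc (k ℕ.+ d) + K (sg (suc k)) * w k d)
      S-suc zero d rewrite ℕₚ.+-identityʳ d =
        solve 2 (λ x y → con (+ 0) := (con (+ 1) :+ y) :* con (+ 0) :+ con (+ 2) :* (x :* y :+ con -[1+ 0 ] :* (x :* con (+ 1) :* y))) refl (Q 0 d) (q ^ suc d)
      S-suc (suc k) d = begin
        S k (suc (suc d)) + t k (suc d)
          ≈⟨ +-congʳ (S-suc k (suc d)) ⟩
        (K (+ 1) + q ^ suc (k ℕ.+ suc d)) * S k (suc d) + K (+ 2) * (Q 0 (k ℕ.+ suc d) * q ^ suc (k ℕ.+ suc d) + e * (Q k (suc d) * b * q ^ (suc k ℕ.* suc (k ℕ.+ suc d)))) + t k (suc d)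
          ≈⟨ +-congʳ (reflexive (≡.cong (λ i → (K (+ 1) + q ^ suc i) * S k (suc d) + K (+ 2) * (Q 0 i * q ^ suc i + e * (Q k (suc d) * b * q ^ (suc k ℕ.* suc i)))) (ℕₚ.+-suc k d))) ⟩
        (K (+ 1) + x) * s + K (+ 2) * (W * x + e * (Q k (suc d) * b * u)) + t k (suc d)
          ≈⟨ +-cong (+-congˡ (*-congˡ (+-congˡ (*-congˡ (*-congʳ (*-congʳ (Q-left k d)))))))
                    (*-congˡ (^-split q (suc k ℕ.* suc (suc k ℕ.+ d)) (suc k) (eq₁ k d))) ⟩
        (K (+ 1) + x) * s + K (+ 2) * (W * x + e * ((K (+ 1) - y) * a * b * u)) + K (+ 2) * e * (a * (K (+ 1) - x)) * b * (u * y)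
          -- The cancellation is (1 - y) + (1 - x) y = (1 + x) - x (1 + y): the part with 1 + x
          -- joins the sum, the part with 1 + y is the next boundary term.
          ≈⟨ solve 8 (λ x y s a b u e W →
               (con (+ 1) :+ x) :* s :+ con (+ 2) :* (W :* x :+ e :* ((con (+ 1) :- y) :* a :* b :* u)) :+ con (+ 2) :* e :* (a :* (con (+ 1) :- x)) :* b :* (u :* y)
               := (con (+ 1) :+ x) :* (s :+ con (+ 2) :* e :* a :* b :* u) :+ con (+ 2) :* (W :* x :+ (:- e) :* (a :* (b :* (con (+ 1) :+ y)) :* (u :* x)))) refl x y s a b u e W ⟩
        (K (+ 1) + x) * (s + K (+ 2) * e * a * b * u) + K (+ 2) * (W * x + (- e) * (a * (b * (K (+ 1) + y)) * (u * x)))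
          ≈⟨ +-congˡ (*-congˡ (+-congˡ (*-cong (K-neg (sg (suc k))) (*-congˡ (^-split q (suc k ℕ.* suc (suc k ℕ.+ d)) (suc (suc (k ℕ.+ d))) (eq₂ k d)))))) ⟨
        (K (+ 1) + x) * (s + t k d) + K (+ 2) * (W * x + K (sg (suc (suc k))) * w (suc k) d) ∎
        where
        e = K (sg (suc k))
        a = Q (suc k) d
        b = D k
        s = S k (suc d)
        x = q ^ suc (suc k ℕ.+ d)
        y = q ^ suc k
        u = q ^ (suc k ℕ.* suc (suc k ℕ.+ d))
        W = Q 0 (suc (k ℕ.+ d))
        eq₁ : ∀ k d → suc k ℕ.* suc (suc k ℕ.+ suc d) ≡ suc k ℕ.* suc (suc k ℕ.+ d) ℕ.+ suc k
        eq₁ = ℕ-Solver.solve-∀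
        eq₂ : ∀ k d → suc (suc k) ℕ.* suc (suc k ℕ.+ d) ≡ suc k ℕ.* suc (suc k ℕ.+ d) ℕ.+ suc (suc (k ℕ.+ d))
        eq₂ = ℕ-Solver.solve-∀

      gauss : ∀ n → D n * φ q n ≈ Q 0 n + S n 0
      gauss zero = trans (*-congˡ (+-congˡ (*-congˡ (sym K-0)))) (solve 0 (con (+ 1) :* (con (+ 1) :+ con (+ 2) :* con (+ 0)) := con (+ 1) :+ con (+ 0)) refl)
      gauss (suc n) = begin
        D n * (K (+ 1) + x) * (K (+ 1) + K (+ 2) * (K (sg (suc n)) * q ^ (suc n ℕ.* suc n) + θ q n))
          ≈⟨ solve 5 (λ D x e y θ → D :* (con (+ 1) :+ x) :* (con (+ 1) :+ con (+ 2) :* (e :* y :+ θ))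
               := D :* (con (+ 1) :+ con (+ 2) :* θ) :* (con (+ 1) :+ x) :+ D :* (con (+ 1) :+ x) :* con (+ 2) :* e :* y) refl (D n) x e y (θ q n) ⟩
        D n * φ q n * (K (+ 1) + x) + D n * (K (+ 1) + x) * K (+ 2) * e * y
          ≈⟨ +-congʳ (*-congʳ (gauss n)) ⟩
        (Q 0 n + S n 0) * (K (+ 1) + x) + D n * (K (+ 1) + x) * K (+ 2) * e * y
          ≈⟨ solve 6 (λ Q S D x e y → (Q :+ S) :* (con (+ 1) :+ x) :+ D :* (con (+ 1) :+ x) :* con (+ 2) :* e :* y
               := Q :* (con (+ 1) :- x) :+ ((con (+ 1) :+ x) :* S :+ con (+ 2) :* (Q :* x :+ e :* (con (+ 1) :* D :* y)) :+ con (+ 2) :* e :* con (+ 1) :* D :* (y :* x))) refl (Q 0 n) (S n 0) (D n) x e y ⟩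
        Q 0 (suc n) + ((K (+ 1) + x) * S n 0 + K (+ 2) * (Q 0 n * x + e * (K (+ 1) * D n * y)) + K (+ 2) * e * K (+ 1) * D n * (y * x))
          -- At d = 0 the boundary term is `D n * y`, with y the new square power. Together with the
          -- last summand `t n 0`, which contributes x times as much, it accounts for the new term
          -- of φ multiplied by `D (suc n)`.
          ≈⟨ +-congˡ (+-cong (trans (S-suc n 0) (reflexive (≡.cong (λ i → (K (+ 1) + q ^ suc i) * S n 0 + K (+ 2) * (Q 0 i * q ^ suc i + e * (K (+ 1) * D n * q ^ (suc n ℕ.* suc i)))) (ℕₚ.+-identityʳ n))))
               (*-congˡ (^-split q (suc n ℕ.* suc n) (suc n) (eq n)))) ⟨
        Q 0 (suc n) + (S n 1 + t n 0) ∎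
        where
        x = q ^ suc n
        e = K (sg (suc n))
        y = q ^ (suc n ℕ.* suc n)
        eq : ∀ n → suc n ℕ.* suc (suc n ℕ.+ 0) ≡ suc n ℕ.* suc n ℕ.+ suc n
        eq = ℕ-Solver.solve-∀

      -- Every summand of `S k d` carries a power of q with exponent at least k + d + 1.
      S-zero : ∀ n k d → (∀ i → n ℕ.< i → q ^ i ≈ 0#) → n ℕ.≤ k ℕ.+ d → S k d ≈ 0#
      S-zero n zero    d q^i≈0 n≤d = K-0
      S-zero n (suc k) d q^i≈0 n≤k+d = begin
        S k (suc d) + t k d
          ≈⟨ +-cong (S-zero n k (suc d) q^i≈0 (ℕₚ.≤-trans n≤k+d (ℕₚ.≤-reflexive (≡.sym (ℕₚ.+-suc k d)))))
                    (*-congˡ (q^i≈0 _ (ℕₚ.<-≤-trans (ℕ.s≤s n≤k+d) (ℕₚ.m≤m+n _ _)))) ⟩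
        0# + K (+ 2) * K (sg (suc k)) * Q (suc k) d * D k * 0#
          ≈⟨ trans (+-identityˡ _) (zeroʳ _) ⟩
        0# ∎

      gauss-truncated : ∀ n → (∀ i → n ℕ.< i → q ^ i ≈ 0#) → D n * φ q n ≈ Q 0 n
      gauss-truncated n q^i≈0 = begin
        D n * φ q n      ≈⟨ gauss n ⟩
        Q 0 n + S n 0    ≈⟨ +-congˡ (S-zero n n 0 q^i≈0 (ℕₚ.m≤m+n n 0)) ⟩
        Q 0 n + 0#       ≈⟨ +-identityʳ _ ⟩
        Q 0 n            ∎

    -- Powers of φ modulo 16

    infix 4 _≡₁₆_
    _≡₁₆_ : Carrier → Carrier → Set
    x ≡₁₆ y = ∃ λ h → x ≈ y + K (+ 16) * h

    -- `c₂` and `c₃` are the binomial coefficients n choose 2 and n choose 3, built by Pascal's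
    -- rule. They stay existential: in the end they multiply quantities that vanish or are even, and
    -- only the linear coefficient enters by its value.
    binomial-mod-16 : ∀ x n → ∃ λ c₂ → ∃ λ c₃ →
      (K (+ 1) + K (+ 2) * x) ^ n ≡₁₆
        K (+ 1) + K (+ 2) * (K (+ n) * x) + K (+ 4) * (K c₂ * (x * x)) + K (+ 8) * (K c₃ * (x * x * x))
    binomial-mod-16 x zero = + 0 , + 0 , K (+ 0) , trans (sym K-1)
      (solve 1 (λ x → con (+ 1) := con (+ 1) :+ con (+ 2) :* (con (+ 0) :* x) :+ con (+ 4) :* (con (+ 0) :* (x :* x)) :+ con (+ 8) :* (con (+ 0) :* (x :* x :* x)) :+ con (+ 16) :* con (+ 0)) refl x)
    binomial-mod-16 x (suc n) with binomial-mod-16 x n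
    ... | c₂ , c₃ , h , eq = c₂ ℤ.+ + n , c₃ ℤ.+ c₂ , K c₃ * (x * x * x * x) + h * (K (+ 1) + K (+ 2) * x) , (begin
      (K (+ 1) + K (+ 2) * x) * (K (+ 1) + K (+ 2) * x) ^ n
        ≈⟨ *-congˡ eq ⟩
      (K (+ 1) + K (+ 2) * x) * (K (+ 1) + K (+ 2) * (K (+ n) * x) + K (+ 4) * (K c₂ * (x * x)) + K (+ 8) * (K c₃ * (x * x * x)) + K (+ 16) * h)
        ≈⟨ solve 5 (λ x n c₂ c₃ h →
             (con (+ 1) :+ con (+ 2) :* x) :* (con (+ 1) :+ con (+ 2) :* (n :* x) :+ con (+ 4) :* (c₂ :* (x :* x)) :+ con (+ 8) :* (c₃ :* (x :* x :* x)) :+ con (+ 16) :* h)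
             := con (+ 1) :+ con (+ 2) :* ((con (+ 1) :+ n) :* x) :+ con (+ 4) :* ((c₂ :+ n) :* (x :* x)) :+ con (+ 8) :* ((c₃ :+ c₂) :* (x :* x :* x)) :+ con (+ 16) :* (c₃ :* (x :* x :* x :* x) :+ h :* (con (+ 1) :+ con (+ 2) :* x)))
             refl x (K (+ n)) (K c₂) (K c₃) h ⟩
      K (+ 1) + K (+ 2) * ((K (+ 1) + K (+ n)) * x) + K (+ 4) * ((K c₂ + K (+ n)) * (x * x)) + K (+ 8) * ((K c₃ + K c₂) * (x * x * x)) + K (+ 16) * h′
        ≈⟨ +-congʳ (+-cong (+-cong (+-congˡ (*-congˡ (*-congʳ (K-+ (+ 1) (+ n))))) (*-congˡ (*-congʳ (K-+ c₂ (+ n))))) (*-congˡ (*-congʳ (K-+ c₃ c₂)))) ⟨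
      K (+ 1) + K (+ 2) * (K (+ suc n) * x) + K (+ 4) * (K (c₂ ℤ.+ + n) * (x * x)) + K (+ 8) * (K (c₃ ℤ.+ c₂) * (x * x * x)) + K (+ 16) * h′ ∎)
      where h′ = K c₃ * (x * x * x * x) + h * (K (+ 1) + K (+ 2) * x)

    ^8-mod-16 : ∀ x n → (K (+ 1) + K (+ 2) * x) ^ (8 ℕ.* n) ≡₁₆ K (+ 1)
    ^8-mod-16 x zero rewrite ℕₚ.*-zeroʳ 8 = K (+ 0) , trans (sym K-1) (solve 0 (con (+ 1) := con (+ 1) :+ con (+ 16) :* con (+ 0)) refl)
    ^8-mod-16 x (suc n) with ^8-mod-16 x n
    ... | h , eq = z + K (+ 4) * (z * z) + (K (+ 1) + K (+ 8) * z) * (K (+ 1) + K (+ 8) * z) * h , (begin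
      (K (+ 1) + K (+ 2) * x) ^ (8 ℕ.* suc n)
        ≈⟨ ^-split _ 8 (8 ℕ.* n) (ℕₚ.*-suc 8 n) ⟩
      (K (+ 1) + K (+ 2) * x) ^ 8 * (K (+ 1) + K (+ 2) * x) ^ (8 ℕ.* n)
        ≈⟨ *-cong pow₈ eq ⟩
      (K (+ 1) + K (+ 8) * z) * (K (+ 1) + K (+ 8) * z) * (K (+ 1) + K (+ 16) * h)
        ≈⟨ solve 2 (λ z h → (con (+ 1) :+ con (+ 8) :* z) :* (con (+ 1) :+ con (+ 8) :* z) :* (con (+ 1) :+ con (+ 16) :* h)
             := con (+ 1) :+ con (+ 16) :* (z :+ con (+ 4) :* (z :* z) :+ (con (+ 1) :+ con (+ 8) :* z) :* (con (+ 1) :+ con (+ 8) :* z) :* h)) refl z h ⟩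
      K (+ 1) + K (+ 16) * (z + K (+ 4) * (z * z) + (K (+ 1) + K (+ 8) * z) * (K (+ 1) + K (+ 8) * z) * h) ∎)
      where
      -- Repeated squaring: (1 + 2x)² = 1 + 4y, its square is 1 + 8z, and the square of that is 1 +
      -- 16 (z + 4z²).
      y = x + x * x
      z = y + K (+ 2) * (y * y)
      pow₈ : (K (+ 1) + K (+ 2) * x) ^ 8 ≈ (K (+ 1) + K (+ 8) * z) * (K (+ 1) + K (+ 8) * z)
      pow₈ = begin
        (K (+ 1) + K (+ 2) * x) ^ 8
          ≈⟨ trans (sym (^-assocʳ (K (+ 1) + K (+ 2) * x) 4 2)) (*-congˡ (*-identityʳ _)) ⟩
        (K (+ 1) + K (+ 2) * x) ^ 4 * (K (+ 1) + K (+ 2) * x) ^ 4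
          ≈⟨ *-cong pow₄ pow₄ ⟩
        (K (+ 1) + K (+ 8) * z) * (K (+ 1) + K (+ 8) * z) ∎
        where
        pow₄ : (K (+ 1) + K (+ 2) * x) ^ 4 ≈ K (+ 1) + K (+ 8) * z
        pow₄ = trans (*-congˡ (*-congˡ (*-congˡ (*-identityʳ _))))
          (solve 1 (λ x → (con (+ 1) :+ con (+ 2) :* x) :* ((con (+ 1) :+ con (+ 2) :* x) :* ((con (+ 1) :+ con (+ 2) :* x) :* (con (+ 1) :+ con (+ 2) :* x)))
            := con (+ 1) :+ con (+ 8) :* ((x :+ x :* x) :+ con (+ 2) :* ((x :+ x :* x) :* (x :+ x :* x)))) refl x)

    sg-cases : ∀ n → sg n ≡ + 1 ⊎ sg n ≡ -[1+ 0 ]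
    sg-cases zero    = inj₁ ≡.refl
    sg-cases (suc n) with sg-cases n
    ... | inj₁ eq rewrite eq = inj₂ ≡.refl
    ... | inj₂ eq rewrite eq = inj₁ ≡.refl

    ^2-^ : ∀ x n → (x ^ 2) ^ n ≈ x ^ n * x ^ n
    ^2-^ x n = trans (^-assocʳ x 2 n) (^-split x n n (≡.cong (n ℕ.+_) (ℕₚ.+-identityʳ n)))

    θ-term² : ∀ q j → ∃ λ c → θ-term q j * θ-term q j ≈ θ-term (q ^ 2) j + K (+ 2) * c
    θ-term² q j with sg (suc j) | sg-cases (suc j)
    ... | _ | inj₁ ≡.refl = K (+ 0) , trans
      (solve 1 (λ x → con (+ 1) :* x :* (con (+ 1) :* x) := con (+ 1) :* (x :* x) :+ con (+ 2) :* con (+ 0)) refl (q ^ (suc j ℕ.* suc j)))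
      (+-congʳ (*-congˡ (sym (^2-^ q (suc j ℕ.* suc j)))))
    ... | _ | inj₂ ≡.refl = q ^ (suc j ℕ.* suc j) * q ^ (suc j ℕ.* suc j) , trans
      (solve 1 (λ x → con -[1+ 0 ] :* x :* (con -[1+ 0 ] :* x) := con -[1+ 0 ] :* (x :* x) :+ con (+ 2) :* (x :* x)) refl (q ^ (suc j ℕ.* suc j)))
      (+-congʳ (*-congˡ (sym (^2-^ q (suc j ℕ.* suc j)))))

    -- Frobenius modulo 2: the cross terms come in pairs, and the signs lost by squaring the terms
    -- are invisible modulo 2.
    θ² : ∀ q n → ∃ λ c → θ q n * θ q n ≈ θ (q ^ 2) n + K (+ 2) * c
    θ² q zero = K (+ 0) , trans (*-cong (sym K-0) (sym K-0))
      (trans (solve 0 (con (+ 0) :* con (+ 0) := con (+ 0) :+ con (+ 2) :* con (+ 0)) refl) (+-congʳ K-0))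
    θ² q (suc n) with θ-term² q n | θ² q n
    ... | c , eq | d , eq′ = c + d + θ-term q n * θ q n , (begin
      (θ-term q n + θ q n) * (θ-term q n + θ q n)
        ≈⟨ solve 2 (λ a b → (a :+ b) :* (a :+ b) := a :* a :+ b :* b :+ con (+ 2) :* (a :* b)) refl (θ-term q n) (θ q n) ⟩
      θ-term q n * θ-term q n + θ q n * θ q n + K (+ 2) * (θ-term q n * θ q n)
        ≈⟨ +-congʳ (+-cong eq eq′) ⟩
      θ-term (q ^ 2) n + K (+ 2) * c + (θ (q ^ 2) n + K (+ 2) * d) + K (+ 2) * (θ-term q n * θ q n)
        ≈⟨ solve 5 (λ a c b d e → a :+ con (+ 2) :* c :+ (b :+ con (+ 2) :* d) :+ con (+ 2) :* e := a :+ b :+ con (+ 2) :* (c :+ d :+ e)) refl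
             (θ-term (q ^ 2) n) c (θ (q ^ 2) n) d (θ-term q n * θ q n) ⟩
      θ-term (q ^ 2) n + θ (q ^ 2) n + K (+ 2) * (c + d + θ-term q n * θ q n) ∎)

    binomial-product-mod-16 : ∀ {P P′} u v w u′ v′ w′ →
      P  ≡₁₆ K (+ 1) + K (+ 2) * u  + K (+ 4) * v  + K (+ 8) * w →
      P′ ≡₁₆ K (+ 1) + K (+ 2) * u′ + K (+ 4) * v′ + K (+ 8) * w′ →
      P * P′ ≡₁₆ K (+ 1) + K (+ 2) * (u + u′) + K (+ 4) * (v + u * u′ + v′) + K (+ 8) * (w + u * v′ + v * u′ + w′)
    binomial-product-mod-16 {P} {P′} u v w u′ v′ w′ (h , eq) (h′ , eq′) = m + (h * X′ + (X + K (+ 16) * h) * h′) , (begin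
      P * P′
        ≈⟨ *-cong eq eq′ ⟩
      (X + K (+ 16) * h) * (X′ + K (+ 16) * h′)
        ≈⟨ solve 4 (λ X X′ h h′ → (X :+ con (+ 16) :* h) :* (X′ :+ con (+ 16) :* h′) := X :* X′ :+ con (+ 16) :* (h :* X′ :+ (X :+ con (+ 16) :* h) :* h′)) refl X X′ h h′ ⟩
      X * X′ + K (+ 16) * (h * X′ + (X + K (+ 16) * h) * h′)
        ≈⟨ +-congʳ (solve 6 (λ u v w u′ v′ w′ →
             (con (+ 1) :+ con (+ 2) :* u :+ con (+ 4) :* v :+ con (+ 8) :* w) :* (con (+ 1) :+ con (+ 2) :* u′ :+ con (+ 4) :* v′ :+ con (+ 8) :* w′)
             := con (+ 1) :+ con (+ 2) :* (u :+ u′) :+ con (+ 4) :* (v :+ u :* u′ :+ v′) :+ con (+ 8) :* (w :+ u :* v′ :+ v :* u′ :+ w′)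
                :+ con (+ 16) :* (u :* w′ :+ v :* v′ :+ w :* u′ :+ con (+ 2) :* (v :* w′ :+ w :* v′) :+ con (+ 4) :* (w :* w′))) refl u v w u′ v′ w′) ⟩
      Y + K (+ 16) * m + K (+ 16) * (h * X′ + (X + K (+ 16) * h) * h′)
        ≈⟨ solve 3 (λ t m n → t :+ con (+ 16) :* m :+ con (+ 16) :* n := t :+ con (+ 16) :* (m :+ n)) refl Y m (h * X′ + (X + K (+ 16) * h) * h′) ⟩
      Y + K (+ 16) * (m + (h * X′ + (X + K (+ 16) * h) * h′)) ∎)
      where
      X  = K (+ 1) + K (+ 2) * u  + K (+ 4) * v  + K (+ 8) * w
      X′ = K (+ 1) + K (+ 2) * u′ + K (+ 4) * v′ + K (+ 8) * w′
      Y = K (+ 1) + K (+ 2) * (u + u′) + K (+ 4) * (v + u * u′ + v′) + K (+ 8) * (w + u * v′ + v * u′ + w′)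
      m = u * w′ + v * v′ + w * u′ + K (+ 2) * (v * w′ + w * v′) + K (+ 4) * (w * w′)

    infix 4 _≡₂_
    _≡₂_ : Carrier → Carrier → Set
    x ≡₂ y = ∃ λ h → x ≈ y + K (+ 2) * h

    ≡₂-reflexive : ∀ {x y} → x ≈ y → x ≡₂ y
    ≡₂-reflexive {x} {y} x≈y = K (+ 0) , trans x≈y (solve 1 (λ y → y := y :+ con (+ 2) :* con (+ 0)) refl y)

    ≡₂-trans : ∀ {x y z} → x ≡₂ y → y ≡₂ z → x ≡₂ z
    ≡₂-trans {z = z} (h , x≈) (k , y≈) = k + h , trans x≈ (trans (+-congʳ y≈)
      (solve 3 (λ z h k → z :+ con (+ 2) :* k :+ con (+ 2) :* h := z :+ con (+ 2) :* (k :+ h)) refl z h k))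

    ≡₂-+ : ∀ {x y x′ y′} → x ≡₂ y → x′ ≡₂ y′ → x + x′ ≡₂ y + y′
    ≡₂-+ {y = y} {y′ = y′} (h , x≈) (k , x′≈) = h + k , trans (+-cong x≈ x′≈)
      (solve 4 (λ y h y′ k → y :+ con (+ 2) :* h :+ (y′ :+ con (+ 2) :* k) := y :+ y′ :+ con (+ 2) :* (h :+ k)) refl y h y′ k)

    ≡₂-*ˡ : ∀ z {x y} → x ≡₂ y → z * x ≡₂ z * y
    ≡₂-*ˡ z {y = y} (h , x≈) = z * h , trans (*-congˡ x≈)
      (solve 3 (λ z y h → z :* (y :+ con (+ 2) :* h) := z :* y :+ con (+ 2) :* (z :* h)) refl z y h)

    ≡₁₆-cong-8 : ∀ {P} T {w z} → P ≡₁₆ T + K (+ 8) * w → w ≡₂ z → P ≡₁₆ T + K (+ 8) * z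
    ≡₁₆-cong-8 {P} T {w} {z} (h , eq) (c , w≈) = c + h , (begin
      P
        ≈⟨ eq ⟩
      T + K (+ 8) * w + K (+ 16) * h
        ≈⟨ +-congʳ (+-congˡ (*-congˡ w≈)) ⟩
      T + K (+ 8) * (z + K (+ 2) * c) + K (+ 16) * h
        ≈⟨ solve 4 (λ T z c h → T :+ con (+ 8) :* (z :+ con (+ 2) :* c) :+ con (+ 16) :* h := T :+ con (+ 8) :* z :+ con (+ 16) :* (c :+ h)) refl T z c h ⟩
      T + K (+ 8) * z + K (+ 16) * (c + h) ∎)

    ≡₁₆-cancel-unit : ∀ {G U V T} → U ≡₁₆ K (+ 1) → G * U ≈ V → V ≡₁₆ T → G ≡₁₆ T
    ≡₁₆-cancel-unit {G} {U} {V} {T} (h , U≈) GU≈V (g , V≈) = g - h * G , (begin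
      G
        ≈⟨ solve 2 (λ G h → G := G :* (con (+ 1) :+ con (+ 16) :* h) :- con (+ 16) :* (h :* G)) refl G h ⟩
      G * (K (+ 1) + K (+ 16) * h) - K (+ 16) * (h * G)
        ≈⟨ +-congʳ (trans (*-congˡ (sym U≈)) (trans GU≈V V≈)) ⟩
      T + K (+ 16) * g - K (+ 16) * (h * G)
        ≈⟨ solve 3 (λ T g h → T :+ con (+ 16) :* g :- con (+ 16) :* h := T :+ con (+ 16) :* (g :- h)) refl T g (h * G) ⟩
      T + K (+ 16) * (g - h * G) ∎)

    module _ (q : Carrier) (n : ℕ) where

      private
        A B C : Carrier
        A = θ q n
        B = θ (q ^ 2) n
        C = θ ((q ^ 2) ^ 2) n

      -- The factor 8 in front leaves only parity, so squares of theta series may be contracted.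
      -- Each cubic monomial becomes a product of at most two theta series, whose coefficients
      -- belong to forms in at most two variables.
      cubic-mod-2 : ∀ a b c₂ c₃ d₂ d₃ →
        c₃ * (A * A * A) + a * A * (d₂ * (B * B)) + c₂ * (A * A) * (b * B) + d₃ * (B * B * B)
          ≡₂ c₃ * (A * B) + a * d₂ * (A * C) + b * c₂ * C + d₃ * (B * C)
      cubic-mod-2 a b c₂ c₃ d₂ d₃ =
        ≡₂-+ (≡₂-+ (≡₂-+ (≡₂-*ˡ c₃ A³) aAd₂B²) c₂A²bB) (≡₂-*ˡ d₃ B³)
        where
        A³ : A * A * A ≡₂ A * B
        A³ = ≡₂-trans (≡₂-reflexive (*-assoc A A A)) (≡₂-*ˡ A (θ² q n))
        B³ : B * B * B ≡₂ B * C
        B³ = ≡₂-trans (≡₂-reflexive (*-assoc B B B)) (≡₂-*ˡ B (θ² (q ^ 2) n))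
        aAd₂B² : a * A * (d₂ * (B * B)) ≡₂ a * d₂ * (A * C)
        aAd₂B² = ≡₂-trans (≡₂-reflexive (solve 4 (λ a A d X → a :* A :* (d :* X) := a :* d :* A :* X) refl a A d₂ (B * B)))
          (≡₂-trans (≡₂-*ˡ (a * d₂ * A) (θ² (q ^ 2) n)) (≡₂-reflexive (*-assoc (a * d₂) A C)))
        c₂A²bB : c₂ * (A * A) * (b * B) ≡₂ b * c₂ * C
        c₂A²bB = ≡₂-trans (≡₂-reflexive (solve 4 (λ c X b B → c :* X :* (b :* B) := b :* c :* B :* X) refl c₂ (A * A) b B))
          (≡₂-trans (≡₂-*ˡ (b * c₂ * B) (θ² q n))
          (≡₂-trans (≡₂-reflexive (*-assoc (b * c₂) B B)) (≡₂-*ˡ (b * c₂) (θ² (q ^ 2) n))))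

      -- Kept exact: with the factor 4 in front its coefficients matter modulo 4, where `θ²` does
      -- not apply.
      quadratic : ℕ → ℕ → ℤ → ℤ → Carrier
      quadratic a b c₂ d₂ = K c₂ * (A * A) + K (+ a) * A * (K (+ b) * B) + K d₂ * (B * B)

      cubic : ℕ → ℕ → ℤ → ℤ → ℤ → ℤ → Carrier
      cubic a b c₂ c₃ d₂ d₃ = K c₃ * (A * B) + K (+ a) * K d₂ * (A * C) + K (+ b) * K c₂ * C + K d₃ * (B * C)

      expansion : ℕ → ℕ → ℤ → ℤ → ℤ → ℤ → Carrier
      expansion a b c₂ c₃ d₂ d₃ =
        K (+ 1) + K (+ 2) * (K (+ a) * A + K (+ b) * B) + K (+ 4) * quadratic a b c₂ d₂ + K (+ 8) * cubic a b c₂ c₃ d₂ d₃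

      expansion-of-product : ∀ a b → ∃ λ c₂ → ∃ λ c₃ → ∃ λ d₂ → ∃ λ d₃ →
        φ q n ^ a * φ (q ^ 2) n ^ b ≡₁₆ expansion a b c₂ c₃ d₂ d₃
      expansion-of-product a b =
        let c₂ , c₃ , φ₁ = binomial-mod-16 A a
            d₂ , d₃ , φ₂ = binomial-mod-16 B b
        in c₂ , c₃ , d₂ , d₃ ,
        ≡₁₆-cong-8 (K (+ 1) + K (+ 2) * (K (+ a) * A + K (+ b) * B) + K (+ 4) * quadratic a b c₂ d₂)
          (binomial-product-mod-16 (K (+ a) * A) (K c₂ * (A * A)) (K c₃ * (A * A * A)) (K (+ b) * B) (K d₂ * (B * B)) (K d₃ * (B * B * B)) φ₁ φ₂)
          (cubic-mod-2 (K (+ a)) (K (+ b)) (K c₂) (K c₃) (K d₂) (K d₃))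

      -- Modulo 16 the inverse of φ is φ⁷, so G is a polynomial in φ(q) and φ(q²).
      expansion-mod-16 : ∀ G s r a → 8 ℕ.* s ≡ s ℕ.+ a → G * φ q n ^ s ≈ φ (q ^ 2) n ^ r →
        ∃ λ c₂ → ∃ λ c₃ → ∃ λ d₂ → ∃ λ d₃ → G ≡₁₆ expansion a r c₂ c₃ d₂ d₃
      expansion-mod-16 G s r a 8s≡s+a Gφ =
        let c₂ , c₃ , d₂ , d₃ , eq = expansion-of-product a r
        in c₂ , c₃ , d₂ , d₃ , ≡₁₆-cancel-unit (^8-mod-16 A s) G*φ⁸ eq
        where
        G*φ⁸ : G * φ q n ^ (8 ℕ.* s) ≈ φ q n ^ a * φ (q ^ 2) n ^ r
        G*φ⁸ = begin
          G * φ q n ^ (8 ℕ.* s)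
            ≈⟨ *-congˡ (^-split (φ q n) s a 8s≡s+a) ⟩
          G * (φ q n ^ s * φ q n ^ a)
            ≈⟨ *-assoc _ _ _ ⟨
          G * φ q n ^ s * φ q n ^ a
            ≈⟨ trans (*-congʳ Gφ) (*-comm _ _) ⟩
          φ q n ^ a * φ (q ^ 2) n ^ r ∎

    -- Sums and products over lists

    sum-++-hom : ∀ {A : Set} (f : A → Carrier) xs ys → sum f (xs ++ ys) ≈ sum f xs + sum f ys
    sum-++-hom f []       ys = sym (+-identityˡ _)
    sum-++-hom f (x ∷ xs) ys = trans (+-congˡ (sum-++-hom f xs ys)) (sym (+-assoc _ _ _))

    sum-cong : ∀ {A : Set} {f g : A → Carrier} → (∀ x → f x ≈ g x) → ∀ xs → sum f xs ≈ sum g xs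
    sum-cong f≈g []       = refl
    sum-cong f≈g (x ∷ xs) = +-cong (f≈g x) (sum-cong f≈g xs)

    sum-*ˡ : ∀ {A : Set} (f : A → Carrier) c xs → sum (λ x → c * f x) xs ≈ c * sum f xs
    sum-*ˡ f c []       = sym (zeroʳ c)
    sum-*ˡ f c (x ∷ xs) = trans (+-congˡ (sum-*ˡ f c xs)) (sym (distribˡ _ _ _))

    sum-map : ∀ {A B : Set} (f : B → Carrier) (g : A → B) xs → sum f (map g xs) ≈ sum (f ∘ g) xs
    sum-map f g []       = refl
    sum-map f g (x ∷ xs) = +-congˡ (sum-map f g xs)

    sum-concatMap : ∀ {A B : Set} (f : B → Carrier) (g : A → List B) xs →
      sum f (concatMap g xs) ≈ sum (λ x → sum f (g x)) xs
    sum-concatMap f g []       = refl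
    sum-concatMap f g (x ∷ xs) = trans (sum-++-hom f (g x) _) (+-congˡ (sum-concatMap f g xs))

    sum-cartesianProductWith : ∀ {A B C : Set} (f : A → Carrier) (g : B → Carrier) (h : C → Carrier) (op : A → B → C) →
      (∀ x y → h (op x y) ≈ f x * g y) → ∀ xs ys → sum h (cartesianProductWith op xs ys) ≈ sum f xs * sum g ys
    sum-cartesianProductWith f g h op eq []       ys = sym (zeroˡ _)
    sum-cartesianProductWith f g h op eq (x ∷ xs) ys = begin
      sum h (map (op x) ys ++ cartesianProductWith op xs ys)
        ≈⟨ sum-++-hom h (map (op x) ys) _ ⟩
      sum h (map (op x) ys) + sum h (cartesianProductWith op xs ys)
        ≈⟨ +-cong (trans (sum-map h (op x) ys) (trans (sum-cong (eq x) ys) (sum-*ˡ g (f x) ys)))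
                  (sum-cartesianProductWith f g h op eq xs ys) ⟩
      f x * sum g ys + sum f xs * sum g ys
        ≈⟨ distribʳ _ _ _ ⟨
      (f x + sum f xs) * sum g ys ∎

    sum-upTo-suc : ∀ (f : ℕ → Carrier) n → sum f (upTo (suc n)) ≈ sum f (upTo n) + f n
    sum-upTo-suc f n = begin
      sum f (upTo (suc n))              ≡⟨ ≡.cong (sum f) (Listₚ.upTo-∷ʳ n) ⟨
      sum f (upTo n List.∷ʳ n)          ≈⟨ sum-++-hom f (upTo n) _ ⟩
      sum f (upTo n) + (f n + 0#)       ≈⟨ +-congˡ (+-identityʳ _) ⟩
      sum f (upTo n) + f n              ∎

    geometric : ∀ x n → (K (+ 1) - x) * sum (λ m → x ^ suc m) (upTo n) ≈ x - x ^ suc n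
    geometric x zero = trans (*-congˡ (sym K-0)) (trans
      (solve 1 (λ x → (con (+ 1) :- x) :* con (+ 0) := x :- x :* con (+ 1)) refl x)
      (+-congˡ (-‿cong (*-congˡ K-1))))
    geometric x (suc n) = begin
      (K (+ 1) - x) * sum (λ m → x ^ suc m) (upTo (suc n))
        ≈⟨ *-congˡ (sum-upTo-suc (λ m → x ^ suc m) n) ⟩
      (K (+ 1) - x) * (sum (λ m → x ^ suc m) (upTo n) + x ^ suc n)
        ≈⟨ distribˡ _ _ _ ⟩
      (K (+ 1) - x) * sum (λ m → x ^ suc m) (upTo n) + (K (+ 1) - x) * x ^ suc n
        ≈⟨ +-congʳ (geometric x n) ⟩
      x - x ^ suc n + (K (+ 1) - x) * x ^ suc n
        ≈⟨ solve 2 (λ x y → x :- y :+ (con (+ 1) :- x) :* y := x :- x :* y) refl x (x ^ suc n) ⟩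
      x - x ^ suc (suc n) ∎

    prod : ∀ {A : Set} → (A → Carrier) → List A → Carrier
    prod f []       = K (+ 1)
    prod f (x ∷ xs) = f x * prod f xs

    prod-++ : ∀ {A : Set} (f : A → Carrier) xs ys → prod f (xs ++ ys) ≈ prod f xs * prod f ys
    prod-++ f []       ys = sym (trans (*-congʳ K-1) (*-identityˡ _))
    prod-++ f (x ∷ xs) ys = trans (*-congˡ (prod-++ f xs ys)) (sym (*-assoc _ _ _))

    -- The generating function as a quotient of theta series

    module Series (q : Carrier) (N : ℕ) (q^i≈0 : ∀ i → N ℕ.< i → q ^ i ≈ 0#) where

      open Gauss q

      weight : ∀ {s} → List (Occurrence s) → ℕ
      weight π = Σℕ (map size π)

      gf : ∀ {s} → List (List (Occurrence s)) → Carrier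
      gf = sum (λ π → q ^ weight π)

      weight-++ : ∀ {s} (π ρ : List (Occurrence s)) → weight (π ++ ρ) ≡ weight π ℕ.+ weight ρ
      weight-++ π ρ = ≡.trans (≡.cong Σℕ (Listₚ.map-++ size π ρ)) (sum-++ (map size π) (map size ρ))

      weight-replicate : ∀ {s} m (κ : ColouredPart s) o → weight (replicate m (occ o κ)) ≡ proj₁ κ ℕ.* m
      weight-replicate zero    κ o = ≡.sym (ℕₚ.*-zeroʳ (proj₁ κ))
      weight-replicate (suc m) κ o = ≡.trans (≡.cong (proj₁ κ ℕ.+_) (weight-replicate m κ o)) (≡.sym (ℕₚ.*-suc (proj₁ κ) m))

      -- Each multiplicity from 1 to N occurs in two ways, so the block sum is 1 + 2 (x + ... + x^N)
      -- with x = q^j. After multiplication by 1 - x the cutoff leaves only a multiple of x^(N+1),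
      -- which vanishes as j ≥ 1.
      gf-blocks : ∀ {s} (κ : ColouredPart s) → 1 ℕ.≤ proj₁ κ →
        (K (+ 1) - q ^ proj₁ κ) * gf (blocks N κ) ≈ K (+ 1) + q ^ proj₁ κ
      gf-blocks κ@(j , c) 1≤j = begin
        (K (+ 1) - x) * gf (blocks N κ)
          ≈⟨ *-congˡ (+-cong (sym K-1) (trans (sum-concatMap _ _ (upTo N)) (trans (sum-cong present (upTo N)) (sum-*ˡ _ (K (+ 2)) (upTo N))))) ⟩
        (K (+ 1) - x) * (K (+ 1) + K (+ 2) * sum (λ m → x ^ suc m) (upTo N))
          ≈⟨ solve 2 (λ x s → (con (+ 1) :- x) :* (con (+ 1) :+ con (+ 2) :* s) := con (+ 1) :- x :+ con (+ 2) :* ((con (+ 1) :- x) :* s)) refl x _ ⟩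
        K (+ 1) - x + K (+ 2) * ((K (+ 1) - x) * sum (λ m → x ^ suc m) (upTo N))
          ≈⟨ +-congˡ (*-congˡ (trans (geometric x N) (+-congˡ (-‿cong (trans (^-assocʳ q j (suc N)) (trans (q^i≈0 _ (ℕₚ.m≤n*m (suc N) j {{ℕ.>-nonZero 1≤j}})) (sym K-0))))))) ⟩
        K (+ 1) - x + K (+ 2) * (x - K (+ 0))
          ≈⟨ solve 1 (λ x → con (+ 1) :- x :+ con (+ 2) :* (x :- con (+ 0)) := con (+ 1) :+ x) refl x ⟩
        K (+ 1) + x ∎
        where
        x = q ^ j
        weight-present : ∀ m → j ℕ.+ weight (replicate m (occ false κ)) ≡ j ℕ.* suc m
        weight-present m = ≡.trans (≡.cong (j ℕ.+_) (weight-replicate m κ false)) (≡.sym (ℕₚ.*-suc j m))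
        present : ∀ m → q ^ (j ℕ.+ weight (replicate m (occ false κ))) + (q ^ (j ℕ.+ weight (replicate m (occ false κ))) + 0#) ≈ K (+ 2) * x ^ suc m
        present m rewrite weight-present m = trans (+-cong (sym (^-assocʳ q j (suc m))) (+-cong (sym (^-assocʳ q j (suc m))) (sym K-0)))
          (solve 1 (λ y → y :+ (y :+ con (+ 0)) := con (+ 2) :* y) refl (x ^ suc m))

      gf-arrangements : ∀ {s} (κs : List (ColouredPart s)) → All (λ κ → 1 ℕ.≤ proj₁ κ) κs →
        gf (arrangements N κs) * prod (λ κ → K (+ 1) - q ^ proj₁ κ) κs ≈ prod (λ κ → K (+ 1) + q ^ proj₁ κ) κs
      gf-arrangements [] [] = trans (*-congʳ (+-identityʳ _)) (*-identityˡ _)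
      gf-arrangements (κ ∷ κs) (1≤κ ∷ 1≤κs) = begin
        gf (arrangements N (κ ∷ κs)) * (u * U)
          ≈⟨ *-congʳ (sum-cartesianProductWith _ _ _ _++_ (λ π ρ → ^-split q (weight π) (weight ρ) (weight-++ π ρ)) (blocks N κ) (arrangements N κs)) ⟩
        gf (blocks N κ) * gf (arrangements N κs) * (u * U)
          ≈⟨ solve 4 (λ b g u U → b :* g :* (u :* U) := (u :* b) :* (g :* U)) refl _ _ u U ⟩
        (u * gf (blocks N κ)) * (gf (arrangements N κs) * U)
          ≈⟨ *-cong (gf-blocks κ 1≤κ) (gf-arrangements κs 1≤κs) ⟩
        (K (+ 1) + q ^ proj₁ κ) * prod (λ κ → K (+ 1) + q ^ proj₁ κ) κs ∎
        where
        u = K (+ 1) - q ^ proj₁ κ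
        U = prod (λ κ → K (+ 1) - q ^ proj₁ κ) κs

      coloured-sizes-positive : ∀ s n → All (λ κ → 1 ℕ.≤ proj₁ κ) (colouredParts s n)
      coloured-sizes-positive s n = Allₚ.concat⁺ (Allₚ.map⁺ (All.universal (λ i → Allₚ.map⁺ (All.universal (λ _ → ℕ.s≤s ℕ.z≤n) (allFin (colours s (suc i))))) (upTo n)))

      -- A factor of the wrong parity is replaced by 1, so that the products over odd and over even
      -- sizes share the bound n and one recursion.
      ifOdd ifEven : Parity → Carrier → Carrier
      ifOdd  0ℙ x = K (+ 1)
      ifOdd  1ℙ x = x
      ifEven 0ℙ x = x
      ifEven 1ℙ x = K (+ 1)

      oddProd evenProd : (ℕ → Carrier) → ℕ → Carrier
      oddProd f zero    = K (+ 1)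
      oddProd f (suc n) = oddProd f n * ifOdd (parity (suc n)) (f (suc n))
      evenProd f zero    = K (+ 1)
      evenProd f (suc n) = evenProd f n * ifEven (parity (suc n)) (f (suc n))

      1^ : ∀ n → K (+ 1) ^ n ≈ K (+ 1)
      1^ zero    = sym K-1
      1^ (suc n) = trans (*-cong K-1 (1^ n)) (*-identityˡ _)

      ^-colours : ∀ s j x → x ^ colours s j ≈ ifOdd (parity j) x ^ s * ifEven (parity j) x
      ^-colours s j x with parity j
      ... | 0ℙ = trans (*-identityʳ x) (sym (trans (*-congʳ (trans (1^ s) K-1)) (*-identityˡ x)))
      ... | 1ℙ = sym (trans (*-congˡ K-1) (*-identityʳ _))

      prod-map-const : ∀ {A B : Set} (f : B → Carrier) (g : A → B) c → (∀ x → f (g x) ≡ c) →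
        ∀ xs → prod f (map g xs) ≈ c ^ length xs
      prod-map-const f g c eq []       = K-1
      prod-map-const f g c eq (x ∷ xs) = *-cong (reflexive (eq x)) (prod-map-const f g c eq xs)

      prod-colouredParts : ∀ (f : ℕ → Carrier) s n →
        prod (λ κ → f (proj₁ κ)) (colouredParts s n) ≈ oddProd f n ^ s * evenProd f n
      prod-colouredParts f s zero = sym (trans (*-congʳ (trans (1^ s) K-1)) (*-identityˡ _))
      prod-colouredParts f s (suc n) = begin
        prod F (concatMap part (upTo (suc n)))
          ≡⟨ ≡.cong (prod F) (≡.trans (≡.cong (concatMap part) (≡.sym (Listₚ.upTo-∷ʳ n))) (Listₚ.concatMap-++ part (upTo n) (n ∷ []))) ⟩
        prod F (colouredParts s n ++ (part n ++ []))
          ≈⟨ prod-++ F (colouredParts s n) _ ⟩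
        prod F (colouredParts s n) * prod F (part n ++ [])
          ≈⟨ *-cong (prod-colouredParts f s n) (trans (reflexive (≡.cong (prod F) (Listₚ.++-identityʳ (part n)))) part-n) ⟩
        oddProd f n ^ s * evenProd f n * (o ^ s * e)
          ≈⟨ solve 4 (λ a b c d → a :* b :* (c :* d) := a :* c :* (b :* d)) refl _ _ _ _ ⟩
        oddProd f n ^ s * o ^ s * (evenProd f n * e)
          ≈⟨ *-congʳ (^-distrib-* (oddProd f n) o s) ⟨
        (oddProd f n * o) ^ s * (evenProd f n * e) ∎
        where
        F : ColouredPart s → Carrier
        F κ = f (proj₁ κ)
        part : ℕ → List (ColouredPart s)
        part i = map (suc i ,_) (allFin (colours s (suc i)))
        o = ifOdd (parity (suc n)) (f (suc n))
        e = ifEven (parity (suc n)) (f (suc n))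
        part-n : prod F (part n) ≈ o ^ s * e
        part-n = begin
          prod F (part n)
            ≈⟨ prod-map-const F (suc n ,_) (f (suc n)) (λ _ → ≡.refl) (allFin (colours s (suc n))) ⟩
          f (suc n) ^ length (allFin (colours s (suc n)))
            ≡⟨ ≡.cong (f (suc n) ^_) (Listₚ.length-tabulate {n = colours s (suc n)} (λ i → i)) ⟩
          f (suc n) ^ colours s (suc n)
            ≈⟨ ^-colours s (suc n) (f (suc n)) ⟩
          o ^ s * e ∎

      -- `g` is given by its recursion because the lemma serves both `D` and `Q 0`.
      oddProd*evenProd : ∀ (f g : ℕ → Carrier) → g 0 ≈ K (+ 1) → (∀ n → g (suc n) ≈ g n * f (suc n)) →
        ∀ n → oddProd f n * evenProd f n ≈ g n
      oddProd*evenProd f g g0 gs zero = trans (*-congʳ K-1) (trans (*-identityˡ _) (sym g0))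
      oddProd*evenProd f g g0 gs (suc n) = begin
        oddProd f n * ifOdd (parity (suc n)) (f (suc n)) * (evenProd f n * ifEven (parity (suc n)) (f (suc n)))
          ≈⟨ solve 4 (λ a b c d → a :* b :* (c :* d) := a :* c :* (b :* d)) refl _ _ _ _ ⟩
        oddProd f n * evenProd f n * (ifOdd (parity (suc n)) (f (suc n)) * ifEven (parity (suc n)) (f (suc n)))
          ≈⟨ *-cong (oddProd*evenProd f g g0 gs n) (odd*even (parity (suc n)) (f (suc n))) ⟩
        g n * f (suc n)
          ≈⟨ gs n ⟨
        g (suc n) ∎
        where
        odd*even : ∀ p x → ifOdd p x * ifEven p x ≈ x
        odd*even 0ℙ x = trans (*-congʳ K-1) (*-identityˡ x)
        odd*even 1ℙ x = trans (*-congˡ K-1) (*-identityʳ x)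

      parity-double : ∀ m → parity (m ℕ.+ m) ≡ 0ℙ
      parity-double zero = ≡.refl
      parity-double (suc m) rewrite ℕₚ.+-suc m m = parity-double m

      -- The even sizes up to 2m are the doubles of 1, ..., m; `g` will be `D` or `Q 0` for q² in
      -- place of q.
      evenProd-double : ∀ (f g : ℕ → Carrier) → g 0 ≈ K (+ 1) → (∀ n → g (suc n) ≈ g n * f (suc n ℕ.+ suc n)) →
        ∀ m → evenProd f (m ℕ.+ m) ≈ g m
      evenProd-double f g g0 gs zero = sym g0
      evenProd-double f g g0 gs (suc m) = begin
        evenProd f (suc m ℕ.+ suc m)
          ≡⟨ ≡.cong (evenProd f) 2+2m ⟩
        evenProd f (suc (suc (m ℕ.+ m)))
          ≈⟨ *-cong (*-cong (evenProd-double f g g0 gs m) (reflexive (≡.cong (λ p → ifEven p (f (suc (m ℕ.+ m)))) (parity-suc-double m))))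
                    (reflexive (≡.cong (λ p → ifEven p (f (suc (suc (m ℕ.+ m))))) (parity-double m))) ⟩
        g m * K (+ 1) * f (suc (suc (m ℕ.+ m)))
          ≈⟨ *-cong (trans (*-congˡ K-1) (*-identityʳ _)) (reflexive (≡.cong f (≡.sym 2+2m))) ⟩
        g m * f (suc m ℕ.+ suc m)
          ≈⟨ gs m ⟨
        g (suc m) ∎
        where
        2+2m : suc m ℕ.+ suc m ≡ suc (suc (m ℕ.+ m))
        2+2m = ≡.cong suc (ℕₚ.+-suc m m)
        parity-suc-double : ∀ m → parity (suc (m ℕ.+ m)) ≡ 1ℙ
        parity-suc-double zero = ≡.refl
        parity-suc-double (suc m) rewrite ℕₚ.+-suc m m = parity-suc-double m

      -- The geometric series of the nilpotent q^j breaks off, so its first N + 1 terms already form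
      -- the inverse.
      1-q^-invertible : ∀ j → 1 ℕ.≤ j → ∃ λ y → (K (+ 1) - q ^ j) * y ≈ K (+ 1)
      1-q^-invertible j 1≤j = K (+ 1) + G , (begin
        (K (+ 1) - x) * (K (+ 1) + G)
          ≈⟨ solve 2 (λ x g → (con (+ 1) :- x) :* (con (+ 1) :+ g) := con (+ 1) :- x :+ (con (+ 1) :- x) :* g) refl x G ⟩
        K (+ 1) - x + (K (+ 1) - x) * G
          ≈⟨ +-congˡ (trans (geometric x N) (+-congˡ (-‿cong (trans (^-assocʳ q j (suc N)) (trans (q^i≈0 _ (ℕₚ.m≤n*m (suc N) j {{ℕ.>-nonZero 1≤j}})) (sym K-0)))))) ⟩
        K (+ 1) - x + (x - K (+ 0))
          ≈⟨ solve 1 (λ x → con (+ 1) :- x :+ (x :- con (+ 0)) := con (+ 1)) refl x ⟩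
        K (+ 1) ∎)
        where
        x = q ^ j
        G = sum (λ m → x ^ suc m) (upTo N)

      Q-invertible : ∀ d → ∃ λ y → Q 0 d * y ≈ K (+ 1)
      Q-invertible zero = K (+ 1) , trans (*-congʳ K-1) (*-identityˡ _)
      Q-invertible (suc d) =
        let y , eq = Q-invertible d
            z , eq′ = 1-q^-invertible (suc d) (ℕ.s≤s ℕ.z≤n)
        in y * z , (begin
          Q 0 d * (K (+ 1) - q ^ suc d) * (y * z)
            ≈⟨ solve 4 (λ a b c d → a :* b :* (c :* d) := a :* c :* (b :* d)) refl _ _ _ _ ⟩
          Q 0 d * y * ((K (+ 1) - q ^ suc d) * z)
            ≈⟨ *-cong eq eq′ ⟩
          K (+ 1) * K (+ 1)
            ≈⟨ trans (*-congʳ K-1) (*-identityˡ _) ⟩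
          K (+ 1) ∎)

      -- A nilpotent q brings zero divisors, so that cancelling a product requires its inverse.
      *-cancel-invertible : ∀ {u v x y} n → u * v ≈ K (+ 1) → u ^ n * x ≈ u ^ n * y → x ≈ y
      *-cancel-invertible {u} {v} {x} {y} n uv≈1 eq = trans (sym (unit x)) (trans (*-congˡ eq) (unit y))
        where
        unit : ∀ x → v ^ n * (u ^ n * x) ≈ x
        unit x = begin
          v ^ n * (u ^ n * x)  ≈⟨ *-assoc _ _ _ ⟨
          v ^ n * u ^ n * x    ≈⟨ *-congʳ (trans (*-comm _ _) (trans (sym (^-distrib-* u v n)) (trans (^-congˡ n uv≈1) (1^ n)))) ⟩
          K (+ 1) * x          ≈⟨ trans (*-congʳ K-1) (*-identityˡ _) ⟩
          x ∎

      -- Gauss's identity for q² holds with M = N/2 terms, whereas the theta series are all taken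
      -- with N terms; the surplus vanishes.
      θ-stable : ∀ x m k → (∀ i → m ℕ.< i → x ^ i ≈ 0#) → θ x (k ℕ.+ m) ≈ θ x m
      θ-stable x m zero    x^i≈0 = refl
      θ-stable x m (suc k) x^i≈0 = begin
        θ-term x (k ℕ.+ m) + θ x (k ℕ.+ m)
          ≈⟨ +-cong (trans (*-congˡ (x^i≈0 _ (ℕₚ.≤-trans (ℕ.s≤s (ℕₚ.m≤n+m m k)) (ℕₚ.m≤m*n (suc (k ℕ.+ m)) (suc (k ℕ.+ m)))))) (zeroʳ _)) (θ-stable x m k x^i≈0) ⟩
        0# + θ x m
          ≈⟨ +-identityˡ _ ⟩
        θ x m ∎

      -- Write O and E for the products over odd and even sizes, with sign + or -, and s = r + 1.
      -- The partitions give G O⁻^s E⁻ = O⁺^s E⁺, and Gauss's identity gives O⁺ E⁺ φ(q) = O⁻ E⁻ and,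
      -- for q², E⁺ φ(q²) = E⁻. Multiplying the claim by (O⁻ E⁻)^s makes these three equations
      -- sufficient. The number of colours is `suc r` so that the exponent s - 1 is a natural
      -- number.
      gf-φ : ∀ M → N ≡ M ℕ.+ M → ∀ r →
        gf (arrangements N (colouredParts (suc r) N)) * φ q N ^ suc r ≈ φ (q ^ 2) N ^ r
      gf-φ M N≡2M r = *-cancel-invertible (suc r) (trans (*-congʳ O⁻E⁻) (proj₂ (Q-invertible N))) (begin
        (O⁻ * E⁻) ^ suc r * (G * φ q N ^ suc r)
          ≈⟨ *-congʳ (^-distrib-* O⁻ E⁻ (suc r)) ⟩
        O⁻ ^ suc r * (E⁻ * E⁻ ^ r) * (G * φ q N ^ suc r)
          ≈⟨ solve 5 (λ o e e′ g f → o :* (e :* e′) :* (g :* f) := g :* (o :* e) :* (e′ :* f)) refl (O⁻ ^ suc r) E⁻ (E⁻ ^ r) G (φ q N ^ suc r) ⟩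
        G * (O⁻ ^ suc r * E⁻) * (E⁻ ^ r * φ q N ^ suc r)
          ≈⟨ *-cong product (*-congʳ (trans (^-congˡ r (sym E⁺φ)) (^-distrib-* E⁺ (φ (q ^ 2) N) r))) ⟩
        O⁺ ^ suc r * E⁺ * (E⁺ ^ r * φ (q ^ 2) N ^ r * φ q N ^ suc r)
          ≈⟨ solve 5 (λ o e e′ g f → o :* e :* (e′ :* g :* f) := o :* (e :* e′) :* f :* g) refl (O⁺ ^ suc r) E⁺ (E⁺ ^ r) (φ (q ^ 2) N ^ r) (φ q N ^ suc r) ⟩
        O⁺ ^ suc r * (E⁺ * E⁺ ^ r) * φ q N ^ suc r * φ (q ^ 2) N ^ r
          ≈⟨ *-congʳ (trans (^-distrib-* (O⁺ * E⁺) (φ q N) (suc r)) (*-congʳ (^-distrib-* O⁺ E⁺ (suc r)))) ⟨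
        (O⁺ * E⁺ * φ q N) ^ suc r * φ (q ^ 2) N ^ r
          ≈⟨ *-congʳ (^-congˡ (suc r) (trans (*-congʳ O⁺E⁺) (trans (gauss-truncated N q^i≈0) (sym O⁻E⁻)))) ⟩
        (O⁻ * E⁻) ^ suc r * φ (q ^ 2) N ^ r ∎)
        where
        module q² = Gauss (q ^ 2)
        G = gf (arrangements N (colouredParts (suc r) N))
        f⁺ f⁻ : ℕ → Carrier
        f⁺ j = K (+ 1) + q ^ j
        f⁻ j = K (+ 1) - q ^ j
        O⁺ = oddProd f⁺ N
        E⁺ = evenProd f⁺ N
        O⁻ = oddProd f⁻ N
        E⁻ = evenProd f⁻ N
        O⁺E⁺ : O⁺ * E⁺ ≈ D N
        O⁺E⁺ = oddProd*evenProd f⁺ D refl (λ _ → refl) N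
        O⁻E⁻ : O⁻ * E⁻ ≈ Q 0 N
        O⁻E⁻ = oddProd*evenProd f⁻ (Q 0) refl (λ _ → refl) N
        product : G * (O⁻ ^ suc r * E⁻) ≈ O⁺ ^ suc r * E⁺
        product = trans (*-congˡ (sym (prod-colouredParts f⁻ (suc r) N)))
          (trans (gf-arrangements (colouredParts (suc r) N) (coloured-sizes-positive (suc r) N)) (prod-colouredParts f⁺ (suc r) N))
        q²^ : ∀ i → (q ^ 2) ^ i ≈ q ^ (i ℕ.+ i)
        q²^ i = trans (^-assocʳ q 2 i) (reflexive (≡.cong (λ k → q ^ (i ℕ.+ k)) (ℕₚ.+-identityʳ i)))
        q²^i≈0 : ∀ i → M ℕ.< i → (q ^ 2) ^ i ≈ 0#
        q²^i≈0 i M<i = trans (q²^ i) (q^i≈0 _ (≡.subst (ℕ._< i ℕ.+ i) (≡.sym N≡2M) (ℕₚ.+-mono-< M<i M<i)))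
        E⁺φ : E⁺ * φ (q ^ 2) N ≈ E⁻
        E⁺φ = begin
          E⁺ * φ (q ^ 2) N
            ≡⟨ ≡.cong (λ n → evenProd f⁺ n * φ (q ^ 2) n) N≡2M ⟩
          evenProd f⁺ (M ℕ.+ M) * φ (q ^ 2) (M ℕ.+ M)
            ≈⟨ *-cong (evenProd-double f⁺ q².D refl (λ n → *-congˡ (+-congˡ (q²^ (suc n)))) M)
                      (+-congˡ (*-congˡ (θ-stable (q ^ 2) M M q²^i≈0))) ⟩
          q².D M * φ (q ^ 2) M
            ≈⟨ q².gauss-truncated M q²^i≈0 ⟩
          q².Q 0 M
            ≈⟨ evenProd-double f⁻ (q².Q 0) refl (λ n → *-congˡ (+-congˡ (-‿cong (q²^ (suc n))))) M ⟨
          evenProd f⁻ (M ℕ.+ M)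
            ≡⟨ ≡.cong (evenProd f⁻) N≡2M ⟨
          E⁻ ∎

  open ≡ using (refl; sym; trans; cong; cong₂; subst; module ≡-Reasoning)

  -- Truncated power series

  Coefficients : Set
  Coefficients = ℕ → ℤ

  infixl 7 _⊛_
  -- Convolution by shifting the first factor, which needs no finite sums; `⊛-suc` is the same
  -- recursion on the second factor, and commutativity comes from comparing the two.
  _⊛_ : Coefficients → Coefficients → Coefficients
  (f ⊛ g) zero    = f 0 ℤ.* g 0
  (f ⊛ g) (suc n) = f 0 ℤ.* g (suc n) ℤ.+ ((f ∘ suc) ⊛ g) n

  constant : ℤ → Coefficients
  constant c zero    = c
  constant c (suc n) = + 0

  infixl 6 _⊕_
  _⊕_ : Coefficients → Coefficients → Coefficients
  (f ⊕ g) n = f n ℤ.+ g n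

  ⊛-cong : ∀ {f f′ g g′} n → (∀ i → i ℕ.≤ n → f i ≡ f′ i) → (∀ i → i ℕ.≤ n → g i ≡ g′ i) → (f ⊛ g) n ≡ (f′ ⊛ g′) n
  ⊛-cong zero    f≡ g≡ = cong₂ ℤ._*_ (f≡ 0 ℕ.z≤n) (g≡ 0 ℕ.z≤n)
  ⊛-cong (suc n) f≡ g≡ = cong₂ ℤ._+_
    (cong₂ ℤ._*_ (f≡ 0 ℕ.z≤n) (g≡ (suc n) ℕₚ.≤-refl))
    (⊛-cong n (λ i i≤n → f≡ (suc i) (ℕ.s≤s i≤n)) (λ i i≤n → g≡ i (ℕₚ.m≤n⇒m≤1+n i≤n)))

  ⊛-suc : ∀ f g n → (f ⊛ g) (suc n) ≡ f (suc n) ℤ.* g 0 ℤ.+ (f ⊛ (g ∘ suc)) n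
  ⊛-suc f g zero    = ℤₚ.+-comm (f 0 ℤ.* g 1) _
  ⊛-suc f g (suc n) = trans (cong (λ z → f 0 ℤ.* g (suc (suc n)) ℤ.+ z) (⊛-suc (f ∘ suc) g n)) (swap (f 0 ℤ.* g (suc (suc n))) (f (suc (suc n)) ℤ.* g 0) (((f ∘ suc) ⊛ (g ∘ suc)) n))
    where
    swap : ∀ a b c → a ℤ.+ (b ℤ.+ c) ≡ b ℤ.+ (a ℤ.+ c)
    swap = ℤ-Solver.solve-∀

  ⊛-comm : ∀ f g n → (f ⊛ g) n ≡ (g ⊛ f) n
  ⊛-comm f g zero    = ℤₚ.*-comm (f 0) (g 0)
  ⊛-comm f g (suc n) = trans (cong₂ ℤ._+_ (ℤₚ.*-comm (f 0) (g (suc n))) (⊛-comm (f ∘ suc) g n)) (sym (⊛-suc g f n))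

  ⊛-distribʳ : ∀ h f g n → ((f ⊕ g) ⊛ h) n ≡ (f ⊛ h) n ℤ.+ (g ⊛ h) n
  ⊛-distribʳ h f g zero    = ℤₚ.*-distribʳ-+ (h 0) (f 0) (g 0)
  ⊛-distribʳ h f g (suc n) =
    trans (cong (λ z → (f 0 ℤ.+ g 0) ℤ.* h (suc n) ℤ.+ z) (⊛-distribʳ h (f ∘ suc) (g ∘ suc) n)) (expand (f 0) (g 0) (h (suc n)) (((f ∘ suc) ⊛ h) n) (((g ∘ suc) ⊛ h) n))
    where
    expand : ∀ a b c x y → (a ℤ.+ b) ℤ.* c ℤ.+ (x ℤ.+ y) ≡ a ℤ.* c ℤ.+ x ℤ.+ (b ℤ.* c ℤ.+ y)
    expand = ℤ-Solver.solve-∀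

  ⊛-scale : ∀ c f g n → ((λ i → c ℤ.* f i) ⊛ g) n ≡ c ℤ.* (f ⊛ g) n
  ⊛-scale c f g zero    = ℤₚ.*-assoc c (f 0) (g 0)
  ⊛-scale c f g (suc n) = trans (cong (λ z → c ℤ.* f 0 ℤ.* g (suc n) ℤ.+ z) (⊛-scale c (f ∘ suc) g n)) (factor c (f 0) (g (suc n)) (((f ∘ suc) ⊛ g) n))
    where
    factor : ∀ c a b x → c ℤ.* a ℤ.* b ℤ.+ c ℤ.* x ≡ c ℤ.* (a ℤ.* b ℤ.+ x)
    factor = ℤ-Solver.solve-∀

  ⊛-assoc : ∀ f g h n → ((f ⊛ g) ⊛ h) n ≡ (f ⊛ (g ⊛ h)) n
  ⊛-assoc f g h zero    = ℤₚ.*-assoc (f 0) (g 0) (h 0)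
  ⊛-assoc f g h (suc n) = begin
    f 0 ℤ.* g 0 ℤ.* h (suc n) ℤ.+ (((λ i → f 0 ℤ.* g (suc i)) ⊕ ((f ∘ suc) ⊛ g)) ⊛ h) n
      ≡⟨ cong (λ z → f 0 ℤ.* g 0 ℤ.* h (suc n) ℤ.+ z) (⊛-distribʳ h _ ((f ∘ suc) ⊛ g) n) ⟩
    f 0 ℤ.* g 0 ℤ.* h (suc n) ℤ.+ (((λ i → f 0 ℤ.* g (suc i)) ⊛ h) n ℤ.+ (((f ∘ suc) ⊛ g) ⊛ h) n)
      ≡⟨ cong (λ z → f 0 ℤ.* g 0 ℤ.* h (suc n) ℤ.+ z) (cong₂ ℤ._+_ (⊛-scale (f 0) (g ∘ suc) h n) (⊛-assoc (f ∘ suc) g h n)) ⟩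
    f 0 ℤ.* g 0 ℤ.* h (suc n) ℤ.+ (f 0 ℤ.* ((g ∘ suc) ⊛ h) n ℤ.+ ((f ∘ suc) ⊛ (g ⊛ h)) n)
      ≡⟨ factor (f 0) (g 0) (h (suc n)) (((g ∘ suc) ⊛ h) n) (((f ∘ suc) ⊛ (g ⊛ h)) n) ⟩
    f 0 ℤ.* (g 0 ℤ.* h (suc n) ℤ.+ ((g ∘ suc) ⊛ h) n) ℤ.+ ((f ∘ suc) ⊛ (g ⊛ h)) n ∎
    where
    open ≡-Reasoning
    factor : ∀ a b c x y → a ℤ.* b ℤ.* c ℤ.+ (a ℤ.* x ℤ.+ y) ≡ a ℤ.* (b ℤ.* c ℤ.+ x) ℤ.+ y
    factor = ℤ-Solver.solve-∀

  ⊛-zeroˡ : ∀ g n → ((λ _ → + 0) ⊛ g) n ≡ + 0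
  ⊛-zeroˡ g zero    = refl
  ⊛-zeroˡ g (suc n) = trans (ℤₚ.+-identityˡ _) (⊛-zeroˡ g n)

  constant-⊛ : ∀ c f n → (constant c ⊛ f) n ≡ c ℤ.* f n
  constant-⊛ c f zero    = refl
  constant-⊛ c f (suc n) = trans (cong (λ z → c ℤ.* f (suc n) ℤ.+ z) (⊛-zeroˡ f n)) (ℤₚ.+-identityʳ _)

  ⊛-identityˡ : ∀ f n → (constant (+ 1) ⊛ f) n ≡ f n
  ⊛-identityˡ f n = trans (constant-⊛ (+ 1) f n) (ℤₚ.*-identityˡ (f n))

  -- ℤ[[q]] / (q^(N+1))
  truncatedSeries : ℕ → CommutativeRing 0ℓ 0ℓ
  truncatedSeries N = record
    { Carrier = Coefficients
    ; _≈_ = λ f g → ∀ i → i ℕ.≤ N → f i ≡ g i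
    ; _+_ = _⊕_
    ; _*_ = _⊛_
    ; -_ = λ f n → ℤ.- f n
    ; 0# = λ _ → + 0
    ; 1# = constant (+ 1)
    ; isCommutativeRing = record
      { isRing = record
        { +-isAbelianGroup = record
          { isGroup = record
            { isMonoid = record
              { isSemigroup = record
                { isMagma = record
                  { isEquivalence = record
                    { refl = λ _ _ → refl
                    ; sym = λ f≈g i i≤N → sym (f≈g i i≤N)
                    ; trans = λ f≈g g≈h i i≤N → trans (f≈g i i≤N) (g≈h i i≤N)
                    }
                  ; ∙-cong = λ f≈ g≈ i i≤N → cong₂ ℤ._+_ (f≈ i i≤N) (g≈ i i≤N)
                  }
                ; assoc = λ f g h i _ → ℤₚ.+-assoc (f i) (g i) (h i)
                }
              ; identity = (λ f i _ → ℤₚ.+-identityˡ (f i)) , (λ f i _ → ℤₚ.+-identityʳ (f i))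
              }
            ; inverse = (λ f i _ → ℤₚ.+-inverseˡ (f i)) , (λ f i _ → ℤₚ.+-inverseʳ (f i))
            ; ⁻¹-cong = λ f≈ i i≤N → cong ℤ.-_ (f≈ i i≤N)
            }
          ; comm = λ f g i _ → ℤₚ.+-comm (f i) (g i)
          }
        ; *-cong = λ f≈ g≈ i i≤N → ⊛-cong i (λ j j≤i → f≈ j (ℕₚ.≤-trans j≤i i≤N)) (λ j j≤i → g≈ j (ℕₚ.≤-trans j≤i i≤N))
        ; *-assoc = λ f g h i _ → ⊛-assoc f g h i
        ; *-identity = (λ f i _ → ⊛-identityˡ f i) , (λ f i _ → trans (⊛-comm f (constant (+ 1)) i) (⊛-identityˡ f i))
        ; distrib = (λ h f g i _ → trans (⊛-comm h (f ⊕ g) i) (trans (⊛-distribʳ h f g i) (cong₂ ℤ._+_ (⊛-comm f h i) (⊛-comm g h i))))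
                  , (λ h f g i _ → ⊛-distribʳ h f g i)
        }
      ; *-comm = λ f g i _ → ⊛-comm f g i
      }
    }

  constants : ∀ N → ℤ-rawRing -Raw-AlmostCommutative⟶ fromCommutativeRing (truncatedSeries N)
  constants N = record
    { ⟦_⟧ = constant
    ; +-homo = λ { a b zero _ → refl ; a b (suc i) _ → refl }
    ; *-homo = λ { a b zero _ → refl ; a b (suc i) _ → sym (trans (constant-⊛ a (constant b) (suc i)) (ℤₚ.*-zeroʳ a)) }
    ; -‿homo = λ { a zero _ → refl ; a (suc i) _ → refl }
    ; 0-homo = λ { zero _ → refl ; (suc i) _ → refl }
    ; 1-homo = λ _ _ → refl
    }

  q : Coefficients
  q 0 = + 0
  q 1 = + 1
  q (suc (suc _)) = + 0

  q-⊛-suc : ∀ f n → (q ⊛ f) (suc n) ≡ f n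
  q-⊛-suc f n = trans (ℤₚ.+-identityˡ _) (trans (⊛-cong n tail-q (λ _ _ → refl)) (⊛-identityˡ f n))
    where
    tail-q : ∀ i → i ℕ.≤ n → q (suc i) ≡ constant (+ 1) i
    tail-q zero    _ = refl
    tail-q (suc i) _ = refl

  -- Coefficients at N and values of quadratic forms

  module Truncation (N : ℕ) where

    open CommutativeRing (truncatedSeries N) using (_≈_; _*_; _+_; *-cong; *-assoc)
      renaming (refl to ≈-refl; sym to ≈-sym; trans to ≈-trans)
    open ThetaSeries (truncatedSeries N) (constants N)

    q^-diag : ∀ k → (q ^ k) k ≡ + 1
    q^-diag zero    = refl
    q^-diag (suc k) = trans (q-⊛-suc (q ^ k) k) (q^-diag k)

    q^-off : ∀ k n → k ≢ n → (q ^ k) n ≡ + 0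
    q^-off zero    zero    k≢n = contradiction refl k≢n
    q^-off zero    (suc n) k≢n = refl
    q^-off (suc k) zero    k≢n = refl
    q^-off (suc k) (suc n) k≢n = trans (q-⊛-suc (q ^ k) n) (q^-off k n (k≢n ∘ cong suc))

    q^i≈0 : ∀ i → N ℕ.< i → q ^ i ≈ (λ _ → + 0)
    q^i≈0 i N<i j j≤N = q^-off i j (ℕₚ.>⇒≢ (ℕₚ.≤-<-trans j≤N N<i))

    open Series q N q^i≈0

    -- For `L = arrangements N (colouredParts s N)` the number on the right is `ā s N` by
    -- definition.
    gf-coefficient : ∀ {s} (L : List (List (Occurrence s))) →
      gf L N ≡ + length (filter (λ π → weight π ℕₚ.≟ N) L)
    gf-coefficient [] = refl
    gf-coefficient (π ∷ L) with weight π ℕₚ.≟ N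
    ... | yes w≡N = trans (cong₂ ℤ._+_ (trans (cong (λ n → (q ^ n) N) w≡N) (q^-diag N)) (gf-coefficient L))
                          (sym (cong (+_ ∘ length) (Listₚ.filter-accept (λ π → weight π ℕₚ.≟ N) {x = π} {xs = L} w≡N)))
    ... | no  w≢N = trans (cong₂ ℤ._+_ (q^-off (weight π) N w≢N) (gf-coefficient L))
                          (sym (cong (+_ ∘ length) (Listₚ.filter-reject (λ π → weight π ℕₚ.≟ N) {x = π} {xs = L} w≢N)))

    module _ {A : Set} (c : A → ℤ) (w : A → ℕ) where

      monomials : List A → Coefficients
      monomials = sum (λ a → K (c a) * q ^ w a)

      monomials-zero : (∀ a → w a ≢ N) → ∀ xs → monomials xs N ≡ + 0
      monomials-zero w≢N []       = refl
      monomials-zero w≢N (a ∷ xs) = cong₂ ℤ._+_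
        (trans (constant-⊛ (c a) (q ^ w a) N) (trans (cong (c a ℤ.*_) (q^-off (w a) N (w≢N a))) (ℤₚ.*-zeroʳ (c a))))
        (monomials-zero w≢N xs)

      matches : List A → ℕ
      matches xs = length (filter (λ a → w a ℕₚ.≟ N) xs)

      -- Both signs are odd, so a signed count has the parity of the plain count; k absorbs the
      -- difference.
      monomials-parity : (∀ a → c a ≡ + 1 ⊎ c a ≡ -[1+ 0 ]) → ∀ xs →
        ∃ λ k → monomials xs N ≡ + matches xs ℤ.+ k ℤ.* + 2
      monomials-parity c=±1 [] = + 0 , refl
      monomials-parity c=±1 (a ∷ xs) with w a ℕₚ.≟ N | monomials-parity c=±1 xs
      ... | no w≢N | k , eq = k , (begin
        (K (c a) * q ^ w a) N ℤ.+ monomials xs N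
          ≡⟨ cong₂ ℤ._+_ (trans (constant-⊛ (c a) (q ^ w a) N) (trans (cong (c a ℤ.*_) (q^-off (w a) N w≢N)) (ℤₚ.*-zeroʳ (c a)))) eq ⟩
        + 0 ℤ.+ (+ matches xs ℤ.+ k ℤ.* + 2)
          ≡⟨ ℤₚ.+-identityˡ _ ⟩
        + matches xs ℤ.+ k ℤ.* + 2
          ≡⟨ cong (λ l → + length l ℤ.+ k ℤ.* + 2) (Listₚ.filter-reject (λ a → w a ℕₚ.≟ N) w≢N) ⟨
        + matches (a ∷ xs) ℤ.+ k ℤ.* + 2 ∎)
        where open ≡-Reasoning
      ... | yes w≡N | k , eq = k ℤ.+ proj₁ odd , (begin
        (K (c a) * q ^ w a) N ℤ.+ monomials xs N
          ≡⟨ cong₂ ℤ._+_ (trans (constant-⊛ (c a) (q ^ w a) N) (trans (cong (c a ℤ.*_) (trans (cong (λ n → (q ^ n) N) w≡N) (q^-diag N))) (ℤₚ.*-identityʳ (c a)))) eq ⟩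
        c a ℤ.+ (+ matches xs ℤ.+ k ℤ.* + 2)
          ≡⟨ cong (ℤ._+ (+ matches xs ℤ.+ k ℤ.* + 2)) (proj₂ odd) ⟩
        + 1 ℤ.+ proj₁ odd ℤ.* + 2 ℤ.+ (+ matches xs ℤ.+ k ℤ.* + 2)
          ≡⟨ regroup (+ matches xs) k (proj₁ odd) ⟩
        + suc (matches xs) ℤ.+ (k ℤ.+ proj₁ odd) ℤ.* + 2
          ≡⟨ cong (λ l → + length l ℤ.+ (k ℤ.+ proj₁ odd) ℤ.* + 2) (Listₚ.filter-accept (λ a → w a ℕₚ.≟ N) w≡N) ⟨
        + matches (a ∷ xs) ℤ.+ (k ℤ.+ proj₁ odd) ℤ.* + 2 ∎)
        where
        open ≡-Reasoning
        odd : ∃ λ e → c a ≡ + 1 ℤ.+ e ℤ.* + 2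
        odd with c=±1 a
        ... | inj₁ c≡1  = + 0 , c≡1
        ... | inj₂ c≡-1 = -[1+ 0 ] , c≡-1
        regroup : ∀ l k e → + 1 ℤ.+ e ℤ.* + 2 ℤ.+ (l ℤ.+ k ℤ.* + 2) ≡ + 1 ℤ.+ l ℤ.+ (k ℤ.+ e) ℤ.* + 2
        regroup = ℤ-Solver.solve-∀

      monomials-even : (∀ a → c a ≡ + 1 ⊎ c a ≡ -[1+ 0 ]) → ∀ xs →
        2 ℕ∣.∣ matches xs → + 2 ℤ∣.∣ monomials xs N
      monomials-even c=±1 xs 2∣length with monomials-parity c=±1 xs
      ... | k , eq = subst (+ 2 ℤ∣.∣_) (sym eq) (ℤ∣.∣m∣n⇒∣m+n (ℤ∣.∣ᵤ⇒∣ {+ 2} {+ matches xs} 2∣length) (divides k refl))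

    -- A, B and C are theta series in q, q² and (q²)². Recording all powers of the argument lets one
    -- lemma relate any product of two of them to a form ax² + by².
    IsPowerOfq : Coefficients → ℕ → Set
    IsPowerOfq x a = ∀ k → x ^ k ≈ q ^ (a ℕ.* k)

    module _ (a b : ℕ) {x y} (x≈q^a : IsPowerOfq x a) (y≈q^b : IsPowerOfq y b) where

      c₂ : ℕ × ℕ → ℤ
      c₂ (i , j) = sg (suc i) ℤ.* sg (suc j)

      w₂ : ℕ × ℕ → ℕ
      w₂ (i , j) = a ℕ.* (suc i ℕ.* suc i) ℕ.+ b ℕ.* (suc j ℕ.* suc j)

      c₂=±1 : ∀ ij → c₂ ij ≡ + 1 ⊎ c₂ ij ≡ -[1+ 0 ]
      c₂=±1 (i , j) with sg (suc i) | sg-cases (suc i) | sg (suc j) | sg-cases (suc j)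
      ... | _ | inj₁ refl | _ | inj₁ refl = inj₁ refl
      ... | _ | inj₁ refl | _ | inj₂ refl = inj₂ refl
      ... | _ | inj₂ refl | _ | inj₁ refl = inj₂ refl
      ... | _ | inj₂ refl | _ | inj₂ refl = inj₁ refl

      θ*θ : ∀ n → θ x n * θ y n ≈ monomials c₂ w₂ (cartesianProduct (downFrom n) (downFrom n))
      θ*θ n = ≈-sym (sum-cartesianProductWith (θ-term x) (θ-term y) (λ ij → K (c₂ ij) * q ^ w₂ ij) _,_ term (downFrom n) (downFrom n))
        where
        open RS using (solve; _:=_; _:*_)
        term : ∀ i j → K (c₂ (i , j)) * q ^ w₂ (i , j) ≈ θ-term x i * θ-term y j
        term i j = ≈-trans (*-cong (K-* (sg (suc i)) (sg (suc j)))
            (≈-trans (^-split q (a ℕ.* (suc i ℕ.* suc i)) (b ℕ.* (suc j ℕ.* suc j)) refl)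
                     (*-cong (≈-sym (x≈q^a (suc i ℕ.* suc i))) (≈-sym (y≈q^b (suc j ℕ.* suc j))))))
          (solve 4 (λ c d u v → (c :* d) :* (u :* v) := (c :* u) :* (d :* v)) ≈-refl
            (K (sg (suc i))) (K (sg (suc j))) (x ^ (suc i ℕ.* suc i)) (y ^ (suc j ℕ.* suc j)))

      θ*θ-zero : (∀ i j → a ℕ.* (i ℕ.* i) ℕ.+ b ℕ.* (j ℕ.* j) ≢ N) → ∀ n → (θ x n * θ y n) N ≡ + 0
      θ*θ-zero ≢N n = trans (θ*θ n N ℕₚ.≤-refl) (monomials-zero c₂ w₂ (λ (i , j) → ≢N (suc i) (suc j)) (cartesianProduct (downFrom n) (downFrom n)))

      θ*θ-even : ∀ n → 2 ℕ∣.∣ matches c₂ w₂ (cartesianProduct (downFrom n) (downFrom n)) →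
        + 2 ℤ∣.∣ (θ x n * θ y n) N
      θ*θ-even n 2∣length = subst (+ 2 ℤ∣.∣_) (sym (θ*θ n N ℕₚ.≤-refl)) (monomials-even c₂ w₂ c₂=±1 (cartesianProduct (downFrom n) (downFrom n)) 2∣length)

    θ-zero : ∀ a {x} → IsPowerOfq x a → (∀ i → a ℕ.* (i ℕ.* i) ≢ N) → ∀ n → θ x n N ≡ + 0
    θ-zero a {x} x≈q^a ≢N n = trans
      (sum-cong (λ i → *-cong ≈-refl (x≈q^a (suc i ℕ.* suc i))) (downFrom n) N ℕₚ.≤-refl)
      (monomials-zero (λ i → sg (suc i)) (λ i → a ℕ.* (suc i ℕ.* suc i)) (λ i → ≢N (suc i)) (downFrom n))

    q-power : IsPowerOfq q 1
    q-power k rewrite ℕₚ.*-identityˡ k = ≈-refl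

    q²-power : IsPowerOfq (q ^ 2) 2
    q²-power = ^-assocʳ q 2

    q⁴-power : IsPowerOfq ((q ^ 2) ^ 2) 4
    q⁴-power k = ≈-trans (^-assocʳ (q ^ 2) 2 k) (≈-trans (^-assocʳ q 2 (2 ℕ.* k)) (λ i _ → cong (λ e → (q ^ e) i) (sym (ℕₚ.*-assoc 2 2 k))))

    -- Spelled out without reference to theta series, yet equal by computation to `matches` for
    -- `θ*θ`. Only positive x and y are counted, hence the shifts by one.
    representations : ℕ → ℕ → ℕ
    representations a b = length (filter (λ (i , j) → a ℕ.* (suc i ℕ.* suc i) ℕ.+ b ℕ.* (suc j ℕ.* suc j) ℕₚ.≟ N) (cartesianProduct (downFrom N) (downFrom N)))

    module _ (N≡6 : N ℕ.% 8 ≡ 6) (even₁₂ : 2 ℕ∣.∣ representations 1 2) (even₂₄ : 2 ℕ∣.∣ representations 2 4) where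

      private
        A B C : Coefficients
        A = θ q N
        B = θ (q ^ 2) N
        C = θ ((q ^ 2) ^ 2) N

      -- None of x², 2x², 4x², x² + y², 2x² + 2y² and x² + 4y² is 6 modulo 8; these are the forms
      -- belonging to A, B, C, AA, BB and AC.
      ≢N : ∀ a b → (∀ (i j : Fin 8) → (a ℕ.* (toℕ i ℕ.* toℕ i) ℕ.+ b ℕ.* (toℕ j ℕ.* toℕ j)) ℕ.% 8 ≢ 6) →
        ∀ x y → a ℕ.* (x ℕ.* x) ℕ.+ b ℕ.* (y ℕ.* y) ≢ N
      ≢N a b avoids = avoids⇒≢ a b 6 avoids N≡6
      ≢N₁ : ∀ a → (∀ (i j : Fin 8) → (a ℕ.* (toℕ i ℕ.* toℕ i) ℕ.+ 0) ℕ.% 8 ≢ 6) → ∀ x → a ℕ.* (x ℕ.* x) ≢ N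
      ≢N₁ a avoids x eq = ≢N a 0 avoids x 0 (trans (ℕₚ.+-identityʳ _) eq)
      A≡0 : A N ≡ + 0
      A≡0 = θ-zero 1 q-power (≢N₁ 1 (from-yes (avoids? 1 0 6))) N
      B≡0 : B N ≡ + 0
      B≡0 = θ-zero 2 q²-power (≢N₁ 2 (from-yes (avoids? 2 0 6))) N
      C≡0 : C N ≡ + 0
      C≡0 = θ-zero 4 q⁴-power (≢N₁ 4 (from-yes (avoids? 4 0 6))) N
      AA≡0 : (A * A) N ≡ + 0
      AA≡0 = θ*θ-zero 1 1 q-power q-power (≢N 1 1 (from-yes (avoids? 1 1 6))) N
      BB≡0 : (B * B) N ≡ + 0
      BB≡0 = θ*θ-zero 2 2 q²-power q²-power (≢N 2 2 (from-yes (avoids? 2 2 6))) N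
      AC≡0 : (A * C) N ≡ + 0
      AC≡0 = θ*θ-zero 1 4 q-power q⁴-power (≢N 1 4 (from-yes (avoids? 1 4 6))) N
      one≡0 : K (+ 1) N ≡ + 0
      one≡0 = constant≡0 N N≡6
        where
        constant≡0 : ∀ n → n ℕ.% 8 ≡ 6 → constant (+ 1) n ≡ + 0
        constant≡0 (suc n) _ = refl
      2∣AB : + 2 ℤ∣.∣ (A * B) N
      2∣AB = θ*θ-even 1 2 q-power q²-power N even₁₂
      2∣BC : + 2 ℤ∣.∣ (B * C) N
      2∣BC = θ*θ-even 2 4 q²-power q⁴-power N even₂₄

      K-coeff : ∀ c f → (K c * f) N ≡ c ℤ.* f N
      K-coeff c f = constant-⊛ c f N

      K*-zero : ∀ c f → f N ≡ + 0 → (K c * f) N ≡ + 0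
      K*-zero c f f≡0 = trans (K-coeff c f) (trans (cong (c ℤ.*_) f≡0) (ℤₚ.*-zeroʳ c))

      KK*-zero : ∀ c d f → f N ≡ + 0 → (K c * K d * f) N ≡ + 0
      KK*-zero c d f f≡0 = trans (*-assoc (K c) (K d) f N ℕₚ.≤-refl) (K*-zero c (K d * f) (K*-zero d f f≡0))

      linear-coefficient : ∀ a b → (K (+ a) * A + K (+ b) * B) N ≡ + 0
      linear-coefficient a b = cong₂ ℤ._+_ (K*-zero (+ a) A A≡0) (K*-zero (+ b) B B≡0)

      quadratic-coefficient : ∀ a b c₂ d₂ → quadratic q N a b c₂ d₂ N ≡ + a ℤ.* + b ℤ.* (A * B) N
      quadratic-coefficient a b c₂ d₂ = begin
        quadratic q N a b c₂ d₂ N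
          ≡⟨ cong₂ ℤ._+_ (cong₂ ℤ._+_ (K*-zero c₂ (A * A) AA≡0) aA*bB) (K*-zero d₂ (B * B) BB≡0) ⟩
        + 0 ℤ.+ + a ℤ.* + b ℤ.* (A * B) N ℤ.+ + 0
          ≡⟨ trans (ℤₚ.+-identityʳ (+ 0 ℤ.+ + a ℤ.* + b ℤ.* (A * B) N)) (ℤₚ.+-identityˡ (+ a ℤ.* + b ℤ.* (A * B) N)) ⟩
        + a ℤ.* + b ℤ.* (A * B) N ∎
        where
        open ≡-Reasoning
        open RS using (solve; _:=_; _:*_)
        aA*bB : (K (+ a) * A * (K (+ b) * B)) N ≡ + a ℤ.* + b ℤ.* (A * B) N
        aA*bB = begin
          (K (+ a) * A * (K (+ b) * B)) N
            ≡⟨ solve 4 (λ a A b B → a :* A :* (b :* B) := a :* (b :* (A :* B))) ≈-refl (K (+ a)) A (K (+ b)) B N ℕₚ.≤-refl ⟩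
          (K (+ a) * (K (+ b) * (A * B))) N
            ≡⟨ trans (K-coeff (+ a) (K (+ b) * (A * B))) (cong (+ a ℤ.*_) (K-coeff (+ b) (A * B))) ⟩
          + a ℤ.* (+ b ℤ.* (A * B) N)
            ≡⟨ ℤₚ.*-assoc (+ a) (+ b) ((A * B) N) ⟨
          + a ℤ.* + b ℤ.* (A * B) N ∎

      cubic-coefficient : ∀ a b c₂ c₃ d₂ d₃ → cubic q N a b c₂ c₃ d₂ d₃ N ≡ c₃ ℤ.* (A * B) N ℤ.+ d₃ ℤ.* (B * C) N
      cubic-coefficient a b c₂ c₃ d₂ d₃ = begin
        cubic q N a b c₂ c₃ d₂ d₃ N
          ≡⟨ cong₂ ℤ._+_ (cong₂ ℤ._+_ (cong₂ ℤ._+_ (K-coeff c₃ (A * B)) (KK*-zero (+ a) d₂ (A * C) AC≡0)) (KK*-zero (+ b) c₂ C C≡0)) (K-coeff d₃ (B * C)) ⟩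
        c₃ ℤ.* (A * B) N ℤ.+ + 0 ℤ.+ + 0 ℤ.+ d₃ ℤ.* (B * C) N
          ≡⟨ cong (ℤ._+ d₃ ℤ.* (B * C) N) (trans (ℤₚ.+-identityʳ (c₃ ℤ.* (A * B) N ℤ.+ + 0)) (ℤₚ.+-identityʳ (c₃ ℤ.* (A * B) N))) ⟩
        c₃ ℤ.* (A * B) N ℤ.+ d₃ ℤ.* (B * C) N ∎
        where open ≡-Reasoning

      expansion-coefficient : ∀ a b c₂ c₃ d₂ d₃ → expansion q N a b c₂ c₃ d₂ d₃ N ≡
        + 4 ℤ.* (+ a ℤ.* + b ℤ.* (A * B) N) ℤ.+ + 8 ℤ.* (c₃ ℤ.* (A * B) N ℤ.+ d₃ ℤ.* (B * C) N)
      expansion-coefficient a b c₂ c₃ d₂ d₃ = begin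
        expansion q N a b c₂ c₃ d₂ d₃ N
          ≡⟨ cong₂ ℤ._+_ (cong₂ ℤ._+_ (cong₂ ℤ._+_ one≡0 (K*-zero (+ 2) (K (+ a) * A + K (+ b) * B) (linear-coefficient a b)))
               (trans (K-coeff (+ 4) (quadratic q N a b c₂ d₂)) (cong (+ 4 ℤ.*_) (quadratic-coefficient a b c₂ d₂))))
               (trans (K-coeff (+ 8) (cubic q N a b c₂ c₃ d₂ d₃)) (cong (+ 8 ℤ.*_) (cubic-coefficient a b c₂ c₃ d₂ d₃))) ⟩
        + 0 ℤ.+ + 4 ℤ.* u ℤ.+ + 8 ℤ.* v
          ≡⟨ cong (ℤ._+ + 8 ℤ.* v) (ℤₚ.+-identityˡ (+ 4 ℤ.* u)) ⟩
        + 4 ℤ.* u ℤ.+ + 8 ℤ.* v ∎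
        where
        open ≡-Reasoning
        u = + a ℤ.* + b ℤ.* (A * B) N
        v = c₃ ℤ.* (A * B) N ℤ.+ d₃ ℤ.* (B * C) N

      -- The quadratic part contributes 4ab times an even coefficient, so the missing factor 2 comes
      -- from ab; in the cubic part, 8 times even coefficients suffices.
      expansion-divisible : ∀ a b c₂ c₃ d₂ d₃ → 2 ℕ∣.∣ a ℕ.* b → ∀ {G} → G ≡₁₆ expansion q N a b c₂ c₃ d₂ d₃ → + 16 ℤ∣.∣ G N
      expansion-divisible a b c₂ c₃ d₂ d₃ 2∣ab {G} (h , G≈) = subst (+ 16 ℤ∣.∣_)
        (sym (trans (G≈ N ℕₚ.≤-refl) (cong₂ ℤ._+_ (expansion-coefficient a b c₂ c₃ d₂ d₃) (K-coeff (+ 16) h))))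
        (ℤ∣.∣m∣n⇒∣m+n (ℤ∣.∣m∣n⇒∣m+n
          (ℤ∣.*-monoʳ-∣ (+ 4) (ℤ∣.∣-trans (ℤ∣.*-monoʳ-∣ (+ 2) 2∣AB) (ℤ∣.*-monoˡ-∣ ((A * B) N) (subst (+ 2 ℤ∣.∣_) (ℤₚ.pos-* a b) (ℤ∣.∣ᵤ⇒∣ {+ 2} {+ (a ℕ.* b)} 2∣ab)))))
          (ℤ∣.*-monoʳ-∣ (+ 8) (ℤ∣.∣m∣n⇒∣m+n (ℤ∣.∣n⇒∣m*n c₃ 2∣AB) (ℤ∣.∣n⇒∣m*n d₃ 2∣BC))))
          (ℤ∣.∣m⇒∣m*n (h N) ℤ∣.∣-refl))

      ā-mod-16 : ∀ M r → N ≡ M ℕ.+ M → 16 ℕ∣.∣ ā (suc r) N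
      ā-mod-16 M r N≡2M =
        -- `gf-φ` consumes s of the 8s factors φ(q), which leaves 7s; here 8s = s + 7s holds by
        -- computation.
        let c₂ , c₃ , d₂ , d₃ , G≡ = expansion-mod-16 q N (gf (arrangements N (colouredParts (suc r) N))) (suc r) r (7 ℕ.* suc r) refl (gf-φ M N≡2M r)
        in ℤ∣.∣⇒∣ᵤ {+ 16} {+ ā (suc r) N}
             (subst (+ 16 ℤ∣.∣_) (gf-coefficient (arrangements N (colouredParts (suc r) N)))
               (expansion-divisible (7 ℕ.* suc r) r c₂ c₃ d₂ d₃ (2∣7[r+1]r r) G≡))
        where
        2∣[n+1]n : ∀ n → 2 ℕ∣.∣ suc n ℕ.* n
        2∣[n+1]n zero    = ℕ∣._∣0 2
        2∣[n+1]n (suc n) = subst (2 ℕ∣.∣_) (step n) (ℕ∣.∣m∣n⇒∣m+n (2∣[n+1]n n) (ℕ∣.m∣m*n (suc n)))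
          where
          step : ∀ n → suc n ℕ.* n ℕ.+ 2 ℕ.* suc n ≡ suc (suc n) ℕ.* suc n
          step = ℕ-Solver.solve-∀
        2∣7[r+1]r : ∀ r → 2 ℕ∣.∣ 7 ℕ.* suc r ℕ.* r
        2∣7[r+1]r r = subst (2 ℕ∣.∣_) (sym (ℕₚ.*-assoc 7 (suc r) r)) (ℕ∣.∣n⇒∣m*n 7 (2∣[n+1]n r))

open GeneratingFunction using (module Truncation)
open ≡ using (refl; sym; trans; cong; cong₂; subst; subst₂; setoid)

-- Parity of the number of representations x² + 2y²

open import Data.List.Membership.Propositional using (_∈_)
open import Data.List.Membership.Propositional.Properties
open import Data.List.Relation.Binary.Permutation.Propositional using (_↭_; ↭-sym; ↭⇒↭ₛ)
open import Data.List.Relation.Binary.Permutation.Propositional.Properties using (shift; ∈-resp-↭; ↭-length)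
import Data.List.Relation.Binary.Permutation.Setoid.Properties as PermSetoid
open import Data.List.Relation.Unary.AllPairs using ([]; _∷_)
open import Data.List.Relation.Unary.Any using (here; there)
open import Data.List.Relation.Unary.Unique.Propositional using (Unique)
import Data.List.Relation.Unary.Unique.Propositional.Properties as Uniqueₚ
open import Data.Nat.Base
open import Data.Nat.Coprimality as Coprimality using (Coprime; coprime-divisor)
open import Data.Nat.Divisibility
open import Data.Nat.GCD using (gcd; c*gcd[m,n]≡gcd[cm,cn]; gcd[m,n]∣m; gcd[m,n]∣n; gcd-greatest)
open import Data.Nat.Primality using (Prime; prime⇒nonZero; prime⇒nonTrivial; prime⇒irreducible; euclidsLemma)
open import Data.Nat.Properties
open import Data.Nat.Tactic.RingSolver using (solve-∀)
open import Data.Sum.Properties using (inj₁-injective; inj₂-injective)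
open import Relation.Binary.Definitions using (tri<; tri≈; tri>)

-- Counting by involutions

module _ {A : Set} (f : A → A) where

  -- Removing x together with f x leaves a list that is still closed under f. As f x may stand
  -- anywhere in the tail, the recursion is on the length.
  even-length-by-involution : ∀ (xs : List A) → Unique xs →
    (∀ {x} → x ∈ xs → f x ∈ xs) → (∀ {x} → x ∈ xs → f (f x) ≡ x) → (∀ {x} → x ∈ xs → f x ≢ x) →
    2 ∣ length xs
  even-length-by-involution xs = go (length xs) xs refl
    where
    go : ∀ n (xs : List A) → length xs ≡ n → Unique xs →
      (∀ {x} → x ∈ xs → f x ∈ xs) → (∀ {x} → x ∈ xs → f (f x) ≡ x) → (∀ {x} → x ∈ xs → f x ≢ x) → 2 ∣ n
    go zero          xs       len u closed inv free = 2 ∣0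
    go (suc zero)    (x ∷ []) len u closed inv free with closed (here refl)
    ... | here fx≡x = contradiction fx≡x (free (here refl))
    go (suc (suc n)) (x ∷ xs) len (x∉xs ∷ u) closed inv free with closed (here refl)
    ... | here fx≡x = contradiction fx≡x (free (here refl))
    ... | there fx∈xs with ∈-∃++ fx∈xs
    ...   | ys , zs , refl = ∣m∣n⇒∣m+n (∣-refl {2}) (go n ws (suc-injective (trans (sym (↭-length perm)) (suc-injective len))) u-ws closed-ws (λ w∈ → inv (lift w∈)) (λ w∈ → free (lift w∈)))
      where
      ws = ys ++ zs
      perm : ys ++ f x ∷ zs ↭ f x ∷ ws
      perm = shift (f x) ys zs
      unique-perm : Unique (f x ∷ ws)
      unique-perm = PermSetoid.Unique-resp-↭ (setoid A) (↭⇒↭ₛ perm) u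
      u-ws : Unique ws
      u-ws with unique-perm
      ... | _ ∷ u′ = u′
      fx∉ws : ∀ {w} → w ∈ ws → f x ≢ w
      fx∉ws w∈ with unique-perm
      ... | fx∉ ∷ _ = All.lookup fx∉ w∈
      lift′ : ∀ {w} → w ∈ ws → w ∈ ys ++ f x ∷ zs
      lift′ w∈ = ∈-resp-↭ (↭-sym perm) (there w∈)
      lift : ∀ {w} → w ∈ ws → w ∈ x ∷ ys ++ f x ∷ zs
      lift w∈ = there (lift′ w∈)
      closed-ws : ∀ {w} → w ∈ ws → f w ∈ ws
      closed-ws {w} w∈ with closed (lift w∈)
      ... | here fw≡x = contradiction (trans (cong f (sym fw≡x)) (inv (lift w∈))) (fx∉ws w∈)
      ... | there fw∈ with ∈-resp-↭ perm fw∈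
      ...   | here fw≡fx = contradiction (trans (sym (inv (here refl))) (trans (cong f (sym fw≡fx)) (inv (lift w∈)))) (All.lookup x∉xs (lift′ w∈))
      ...   | there fw∈ws = fw∈ws

-- Jackson's involution

-- Inequalities are supplied as equations with a slack variable: the same equation decides the
-- Boolean test and evaluates the truncated subtraction.
<ᵇ-true : ∀ {m n} k → n ≡ m + suc k → (m <ᵇ n) ≡ true
<ᵇ-true {m} k refl = T⇒≡true (<⇒<ᵇ (m<m+n m z<s))
  where
  T⇒≡true : ∀ {b} → T b → b ≡ true
  T⇒≡true {true} _ = refl

<ᵇ-false : ∀ {m n} k → m ≡ n + k → (m <ᵇ n) ≡ false
<ᵇ-false {m} {n} k refl = ¬T⇒≡false (λ t → m+n≮m n k (<ᵇ⇒< (n + k) n t))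
  where
  ¬T⇒≡false : ∀ {b} → ¬ T b → b ≡ false
  ¬T⇒≡false {false} _ = refl
  ¬T⇒≡false {true} ¬t = contradiction _ ¬t

≡ᵇ-true : ∀ m → (m ≡ᵇ m) ≡ true
≡ᵇ-true zero    = refl
≡ᵇ-true (suc m) = ≡ᵇ-true m

≡ᵇ-false : ∀ {m n} k → m ≡ n + suc k → (m ≡ᵇ n) ≡ false
≡ᵇ-false {n = zero}  k refl = refl
≡ᵇ-false {n = suc n} k refl = ≡ᵇ-false {n = n} k refl

Triple : Set
Triple = ℕ × ℕ × ℕ

∸-of-sum : ∀ {m n} k → m ≡ n + k → m ∸ n ≡ k
∸-of-sum {n = n} k refl = m+n∸m≡n n k

bound₄ : ∀ x z g h → x + z ≡ g + h → 3 * x + 2 * z ≡ 2 * x + z + g + h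
bound₄ x z g h eq = trans (l x z) (trans (cong (λ s → 2 * x + z + s) eq) (sym (+-assoc (2 * x + z) g h)))
  where
  l : ∀ x z → 3 * x + 2 * z ≡ 2 * x + z + (x + z)
  l = solve-∀

double₅ : ∀ x z h k → x + 2 * z ≡ h + 2 * suc k → 2 * (x + h + suc k) ≡ 3 * x + 2 * z + h
double₅ x z h k eq = trans (l x h k) (trans (cong (2 * x + h +_) (sym eq)) (r x z h))
  where
  l : ∀ x h k → 2 * (x + h + suc k) ≡ 2 * x + h + (h + 2 * suc k)
  l = solve-∀
  r : ∀ x z h → 2 * x + h + (x + 2 * z) ≡ 3 * x + 2 * z + h
  r = solve-∀
off-diagonal₅ : ∀ x z h k → x + 2 * z ≡ h + 2 * suc k → 3 * x + 2 * z + h ≡ 2 * x + suc (h + (h + 2 * k + 1))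
off-diagonal₅ x z h k eq = trans (l x z h) (trans (cong (λ s → 2 * x + h + s) eq) (r x h k))
  where
  l : ∀ x z h → 3 * x + 2 * z + h ≡ 2 * x + h + (x + 2 * z)
  l = solve-∀
  r : ∀ x h k → 2 * x + h + (h + 2 * suc k) ≡ 2 * x + suc (h + (h + 2 * k + 1))
  r = solve-∀
bound₅ : ∀ x z h k → x + 2 * z ≡ h + 2 * suc k → 4 * x + 4 * z ≡ 3 * x + 2 * z + h + suc (suc (2 * k))
bound₅ x z h k eq = trans (l x z) (trans (cong (λ s → 3 * x + 2 * z + s) eq) (r x z h k))
  where
  l : ∀ x z → 4 * x + 4 * z ≡ 3 * x + 2 * z + (x + 2 * z)
  l = solve-∀
  r : ∀ x z h k → 3 * x + 2 * z + (h + 2 * suc k) ≡ 3 * x + 2 * z + h + suc (suc (2 * k))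
  r = solve-∀
third₅ : ∀ x z h k → x + 2 * z ≡ h + 2 * suc k → 2 * x + 2 * z ≡ x + h + suc k + suc k
third₅ x z h k eq = trans (l x z) (trans (cong (x +_) eq) (r x h k))
  where
  l : ∀ x z → 2 * x + 2 * z ≡ x + (x + 2 * z)
  l = solve-∀
  r : ∀ x h k → x + (h + 2 * suc k) ≡ x + h + suc k + suc k
  r = solve-∀

module Jackson (δ : ℕ → ℕ → Triple) where

  -- Jackson's involution on x² + 2yz = M, with v = 2y; on the boundary x = y, where
  -- x (x + 2z) = M, it is given by δ.
  dispatch : ℕ → Triple → Triple
  dispatch v (x , y , z) =
    if v <ᵇ x then (x ∸ v , z + (2 * (x ∸ v) + v) , y) else
    if v <ᵇ 2 * x then (v ∸ x , y , z + 2 * (x ∸ y)) else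
    if v ≡ᵇ 2 * x then δ x z else
    if v <ᵇ 2 * x + z then (v ∸ x , y , z ∸ 2 * (y ∸ x)) else
    if v <ᵇ 3 * x + 2 * z then (3 * x + 2 * z ∸ v , 2 * x + 2 * z ∸ y , v ∸ (2 * x + z)) else
    if v <ᵇ 4 * x + 4 * z then (v ∸ (3 * x + 2 * z) , v ∸ (2 * x + z) , 2 * x + 2 * z ∸ y) else
    (x + 2 * z , z , y ∸ (2 * x + 2 * z))

  jackson : Triple → Triple
  jackson (x , y , z) = dispatch (2 * y) (x , y , z)

  -- In the lemmas for the single branches v stays separate from 2y, so that rewriting meets the
  -- tests before any constructor of y makes them unfold.
  dispatch₁ : ∀ v x y z {t} → x ≡ v + suc t → dispatch v (x , y , z) ≡ (suc t , z + (2 * suc t + v) , y)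
  dispatch₁ v x y z {t} x≡ rewrite <ᵇ-true {v} {x} t x≡ | ∸-of-sum {x} {v} (suc t) x≡ = refl

  dispatch₂ : ∀ v x y z {u s t} → v ≡ x + u → 2 * x ≡ v + suc s → x ≡ y + t →
    dispatch v (x , y , z) ≡ (u , y , z + 2 * t)
  dispatch₂ v x y z {u} {s} {t} v≡ 2x≡ x≡
    rewrite <ᵇ-false {v} {x} u v≡ | <ᵇ-true {v} {2 * x} s 2x≡
          | ∸-of-sum {v} {x} u v≡ | ∸-of-sum {x} {y} t x≡ = refl

  dispatch-diagonal : ∀ x y z → dispatch (2 * x) (x , y , z) ≡ δ x z
  dispatch-diagonal x y z
    rewrite <ᵇ-false {2 * x} {x} x (cong (x +_) (+-identityʳ x))
          | <ᵇ-false {2 * x} {2 * x} 0 (sym (+-identityʳ (2 * x)))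
          | ≡ᵇ-true (2 * x) = refl

  dispatch₃ : ∀ v x y z {a s r t} → v ≡ x + a → v ≡ 2 * x + suc s → 2 * x + z ≡ v + suc r → y ≡ x + t → z ≡ suc r + 2 * t →
    dispatch v (x , y , z) ≡ (a , y , suc r)
  dispatch₃ v x y z {a} {s} {r} {t} v≡x v≡2x v< y≡ z≡
    rewrite <ᵇ-false {v} {x} a v≡x | <ᵇ-false {v} {2 * x} (suc s) v≡2x | ≡ᵇ-false {v} {2 * x} s v≡2x
          | <ᵇ-true {v} {2 * x + z} r v<
          | ∸-of-sum {v} {x} a v≡x | ∸-of-sum {y} {x} t y≡ | z≡ | m+n∸n≡m (suc r) (2 * t) = refl

  dispatch₄ : ∀ v x y z {a b g h y′} → v ≡ x + a → v ≡ 2 * x + suc b → v ≡ 2 * x + z + g → 3 * x + 2 * z ≡ v + suc h → 2 * x + 2 * z ≡ y + y′ →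
    dispatch v (x , y , z) ≡ (suc h , y′ , g)
  dispatch₄ v x y z {a} {b} {g} {h} {y′} v≡x v≡2x v≡ v< y+y′
    rewrite <ᵇ-false {v} {x} a v≡x | <ᵇ-false {v} {2 * x} (suc b) v≡2x | ≡ᵇ-false {v} {2 * x} b v≡2x
          | <ᵇ-false {v} {2 * x + z} g v≡ | <ᵇ-true {v} {3 * x + 2 * z} h v<
          | ∸-of-sum {3 * x + 2 * z} {v} (suc h) v< | ∸-of-sum {2 * x + 2 * z} {y} y′ y+y′ | ∸-of-sum {v} {2 * x + z} g v≡ = refl

  dispatch₅ : ∀ v x y z {a b c h l k} → v ≡ x + a → v ≡ 2 * x + suc b → v ≡ 2 * x + z + c → v ≡ 3 * x + 2 * z + h →
    4 * x + 4 * z ≡ v + suc l → 2 * x + 2 * z ≡ y + k → dispatch v (x , y , z) ≡ (h , c , k)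
  dispatch₅ v x y z {a} {b} {c} {h} {l} {k} v≡x v≡2x v≡c v≡h v< y+k
    rewrite <ᵇ-false {v} {x} a v≡x | <ᵇ-false {v} {2 * x} (suc b) v≡2x | ≡ᵇ-false {v} {2 * x} b v≡2x
          | <ᵇ-false {v} {2 * x + z} c v≡c | <ᵇ-false {v} {3 * x + 2 * z} h v≡h | <ᵇ-true {v} {4 * x + 4 * z} l v<
          | ∸-of-sum {v} {3 * x + 2 * z} h v≡h | ∸-of-sum {v} {2 * x + z} c v≡c | ∸-of-sum {2 * x + 2 * z} {y} k y+k = refl

  dispatch₆ : ∀ v x y z {a b c d e w} → v ≡ x + a → v ≡ 2 * x + suc b → v ≡ 2 * x + z + c → v ≡ 3 * x + 2 * z + d →
    v ≡ 4 * x + 4 * z + e → y ≡ 2 * x + 2 * z + w → dispatch v (x , y , z) ≡ (x + 2 * z , z , w)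
  dispatch₆ v x y z {a} {b} {c} {d} {e} {w} v≡x v≡2x v≡c v≡d v≡e y≡
    rewrite <ᵇ-false {v} {x} a v≡x | <ᵇ-false {v} {2 * x} (suc b) v≡2x | ≡ᵇ-false {v} {2 * x} b v≡2x
          | <ᵇ-false {v} {2 * x + z} c v≡c | <ᵇ-false {v} {3 * x + 2 * z} d v≡d | <ᵇ-false {v} {4 * x + 4 * z} e v≡e
          | ∸-of-sum {y} {2 * x + 2 * z} w y≡ = refl

  jackson₁ : ∀ y z t → jackson (2 * y + suc t , y , z) ≡ (suc t , z + (2 * suc t + 2 * y) , y)
  jackson₁ y z t = dispatch₁ (2 * y) (2 * y + suc t) y z refl

  jackson₂ : ∀ t u z → jackson (2 * suc t + u , suc t + u , z) ≡ (u , suc t + u , z + 2 * suc t)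
  jackson₂ t u z = dispatch₂ (2 * (suc t + u)) (2 * suc t + u) (suc t + u) z (e₁ t u) (e₂ t u) (e₃ t u)
    where
    e₁ : ∀ t u → 2 * (suc t + u) ≡ 2 * suc t + u + u
    e₁ = solve-∀
    e₂ : ∀ t u → 2 * (2 * suc t + u) ≡ 2 * (suc t + u) + suc (suc (2 * t))
    e₂ = solve-∀
    e₃ : ∀ t u → 2 * suc t + u ≡ suc t + u + suc t
    e₃ = solve-∀

  jackson-diagonal : ∀ x z → jackson (x , x , z) ≡ δ x z
  jackson-diagonal x z = dispatch-diagonal x x z

  jackson₃ : ∀ t u r → jackson (u , suc t + u , suc r + 2 * suc t) ≡ (2 * suc t + u , suc t + u , suc r)
  jackson₃ t u r = dispatch₃ (2 * (suc t + u)) u (suc t + u) (suc r + 2 * suc t) (e₁ t u) (e₂ t u) (e₃ t u r) (+-comm (suc t) u) refl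
    where
    e₁ : ∀ t u → 2 * (suc t + u) ≡ u + (2 * suc t + u)
    e₁ = solve-∀
    e₂ : ∀ t u → 2 * (suc t + u) ≡ 2 * u + suc (suc (2 * t))
    e₂ = solve-∀
    e₃ : ∀ t u r → 2 * u + (suc r + 2 * suc t) ≡ 2 * (suc t + u) + suc r
    e₃ = solve-∀

  jackson₄ : ∀ x y z g h y′ → x + z ≡ suc g + suc h → 2 * y ≡ 2 * x + z + suc g → y + y′ ≡ 2 * x + 2 * z →
    jackson (x , y , z) ≡ (suc h , y′ , suc g)
  jackson₄ x y z g h y′ x+z≡g+h 2y≡ y+y′≡ = dispatch₄ (2 * y) x y z (trans 2y≡ (e₁ x z g)) (trans 2y≡ (e₂ x z g)) 2y≡
    (trans (bound₄ x z (suc g) (suc h) x+z≡g+h) (cong (_+ suc h) (sym 2y≡))) (sym y+y′≡)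
    where
    e₁ : ∀ x z g → 2 * x + z + suc g ≡ x + (x + z + suc g)
    e₁ = solve-∀
    e₂ : ∀ x z g → 2 * x + z + suc g ≡ 2 * x + suc (z + g)
    e₂ = solve-∀

  jackson₅ : ∀ x z h k → x + 2 * z ≡ h + 2 * suc k → jackson (x , x + h + suc k , z) ≡ (h , h + x + z , suc k)
  jackson₅ x z h k eq = dispatch₅ (2 * (x + h + suc k)) x (x + h + suc k) z (trans 2y≡ (e₁ x z h)) (trans 2y≡ (off-diagonal₅ x z h k eq)) (trans 2y≡ (e₃ x z h)) 2y≡
    (trans (bound₅ x z h k eq) (cong (_+ suc (suc (2 * k))) (sym 2y≡))) (third₅ x z h k eq)
    where
    2y≡ = double₅ x z h k eq
    e₁ : ∀ x z h → 3 * x + 2 * z + h ≡ x + (2 * x + 2 * z + h)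
    e₁ = solve-∀
    e₃ : ∀ x z h → 3 * x + 2 * z + h ≡ 2 * x + z + (h + x + z)
    e₃ = solve-∀

  jackson₆ : ∀ x z w → jackson (suc x , 2 * suc x + 2 * z + w , z) ≡ (suc x + 2 * z , z , w)
  jackson₆ x z w = dispatch₆ (2 * (2 * suc x + 2 * z + w)) (suc x) (2 * suc x + 2 * z + w) z (e₁ x z w) (e₂ x z w) (e₃ x z w) (e₄ x z w) (e₅ x z w) refl
    where
    e₁ : ∀ x z w → 2 * (2 * suc x + 2 * z + w) ≡ suc x + (3 * suc x + 4 * z + 2 * w)
    e₁ = solve-∀
    e₂ : ∀ x z w → 2 * (2 * suc x + 2 * z + w) ≡ 2 * suc x + suc (suc (2 * x + 4 * z + 2 * w))
    e₂ = solve-∀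
    e₃ : ∀ x z w → 2 * (2 * suc x + 2 * z + w) ≡ 2 * suc x + z + (2 * suc x + 3 * z + 2 * w)
    e₃ = solve-∀
    e₄ : ∀ x z w → 2 * (2 * suc x + 2 * z + w) ≡ 3 * suc x + 2 * z + (suc x + 2 * z + 2 * w)
    e₄ = solve-∀
    e₅ : ∀ x z w → 2 * (2 * suc x + 2 * z + w) ≡ 4 * suc x + 4 * z + 2 * w
    e₅ = solve-∀

-- Odd solutions and the branches of the involution

Odd : ℕ → Set
Odd n = ∃ λ k → n ≡ suc (2 * k)

even⊎odd : ∀ n → (∃ λ k → n ≡ 2 * k) ⊎ Odd n
even⊎odd zero = inj₁ (0 , refl)
even⊎odd (suc n) with even⊎odd n
... | inj₁ (k , refl) = inj₂ (k , refl)
... | inj₂ (k , refl) = inj₁ (suc k , sym (*-suc 2 k))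

odd-nonzero : ∀ {n} → Odd n → ∃ λ k → n ≡ suc k
odd-nonzero (k , eq) = 2 * k , eq

IsSolution : ℕ → Triple → Set
IsSolution M (x , y , z) = x * x + 2 * (y * z) ≡ M

-- The branches parametrized so that no subtraction remains. Branches 1 and 6 are inverse to each
-- other, as are 2 and 3; branches 4 and 5 are inverse to themselves.
data View : Triple → Set where
  view₁ : ∀ y z t → View (2 * y + suc t , y , z)
  view₂ : ∀ t u z → View (2 * suc t + u , suc t + u , z)
  view-diagonal : ∀ x z → View (x , x , z)
  view₃ : ∀ t u r → View (u , suc t + u , suc r + 2 * suc t)
  view₄ : ∀ x y z g h y′ → x + z ≡ suc g + suc h → 2 * y ≡ 2 * x + z + suc g → y + y′ ≡ 2 * x + 2 * z → View (x , y , z)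
  view₅ : ∀ x z h k → x + 2 * z ≡ h + 2 * suc k → View (x , x + h + suc k , z)
  view₆ : ∀ x z w → View (suc x , 2 * suc x + 2 * z + w , z)

m<n⇒n≡m+1+k : ∀ {m n} → m < n → ∃ λ k → n ≡ m + suc k
m<n⇒n≡m+1+k {m} m<n = let k , eq = m≤n⇒∃[o]m+o≡n m<n in k , trans (sym eq) (sym (+-suc m k))

view-below : ∀ x z s r → 1 ≤ s → z ≡ 2 * s + suc r → View (x , x + s , z)
view-below x _ (suc t) r _ refl =
  subst₂ (λ y z → View (x , y , z)) (+-comm (suc t) x) (+-comm (suc r) (2 * suc t)) (view₃ t x r)

-- Here y = x + s. The boundaries 2y = 2x + z, 2y = 3x + 2z and y = 2x + 2z are excluded by the
-- oddness of z, x and y respectively.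
view-above : ∀ x z s → Odd x → Odd (x + s) → Odd z → 1 ≤ s → View (x , x + s , z)
view-above x z s (a , x≡) (b , y≡) (c , z≡) 1≤s with <-cmp (2 * s) z
... | tri≈ _ 2s≡z _ = contradiction (trans 2s≡z z≡) (even≢odd s c)
... | tri< 2s<z _ _ with m<n⇒n≡m+1+k 2s<z
...   | r , eq = view-below x z s r 1≤s eq
view-above x z s (a , x≡) (b , y≡) (c , z≡) 1≤s | tri> _ _ z<2s with m<n⇒n≡m+1+k z<2s
... | g , 2s≡z+g with <-cmp (suc g) (x + z)
...   | tri≈ _ g≡x+z _ = contradiction
          (trans 2s≡z+g (trans (cong (z +_) (trans g≡x+z (cong (_+ z) x≡))) (rearrange a z)))
          (even≢odd s (a + z))
  where
  rearrange : ∀ a z → z + (suc (2 * a) + z) ≡ suc (2 * (a + z))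
  rearrange = solve-∀
...   | tri< g<x+z _ _ with m<n⇒n≡m+1+k g<x+z
...     | h , x+z≡g+h = view₄ x (x + s) z g h (proj₁ half) x+z≡g+h 2y≡ (proj₂ half)
  where
  2y≡ : 2 * (x + s) ≡ 2 * x + z + suc g
  2y≡ = trans (*-distribˡ-+ 2 x s) (trans (cong (2 * x +_) 2s≡z+g) (sym (+-assoc (2 * x) z (suc g))))
  -- The bound y ≤ 2x + 2z is proved after doubling, where the known value of 2y can be inserted.
  doubled : 2 * (2 * x + 2 * z) ≡ 2 * (x + s) + (x + 2 * z + suc h)
  doubled = trans (l x z) (trans (cong (λ s → 3 * x + 3 * z + s) x+z≡g+h) (trans (r x z g h) (cong (_+ (x + 2 * z + suc h)) (sym 2y≡))))
    where
    l : ∀ x z → 2 * (2 * x + 2 * z) ≡ 3 * x + 3 * z + (x + z)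
    l = solve-∀
    r : ∀ x z g h → 3 * x + 3 * z + (suc g + suc h) ≡ 2 * x + z + suc g + (x + 2 * z + suc h)
    r = solve-∀
  half : ∃ λ y′ → x + s + y′ ≡ 2 * x + 2 * z
  half = m≤n⇒∃[o]m+o≡n (*-cancelˡ-≤ 2 (≤-trans (m≤m+n (2 * (x + s)) (x + 2 * z + suc h)) (≤-reflexive (sym doubled))))
view-above x z s (a , x≡) (b , y≡) (c , z≡) 1≤s | tri> _ _ z<2s | g , 2s≡z+g | tri> _ _ x+z<g with m<n⇒n≡m+1+k x+z<g | <-cmp s (x + 2 * z)
... | h , g≡ | tri≈ _ s≡ _ = contradiction (trans (trans (rearrange x z) (cong (x +_) (sym s≡))) y≡) (even≢odd (x + z) b)
  where
  rearrange : ∀ x z → 2 * (x + z) ≡ x + (x + 2 * z)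
  rearrange = solve-∀
... | h , g≡ | tri< s<x+2z _ _ with m<n⇒n≡m+1+k s<x+2z
...   | k , x+2z≡ = subst (λ y → View (x , y , z)) (trans (+-assoc x (suc h) (suc k)) (cong (x +_) (sym s≡)))
          (view₅ x z (suc h) k (trans x+2z≡ (trans (cong (_+ suc k) s≡) (expand (suc h) (suc k)))))
  where
  expand : ∀ h k → h + k + k ≡ h + 2 * k
  expand = solve-∀
  s≡ : s ≡ suc h + suc k
  s≡ = +-cancelˡ-≡ s s (suc h + suc k) (trans (cong (s +_) (sym (+-identityʳ s))) (trans 2s≡z+g (trans (cong (z +_) g≡) (trans (l x z h) (trans (cong (_+ suc h) x+2z≡) (r s h k))))))
    where
    l : ∀ x z h → z + (x + z + suc h) ≡ x + 2 * z + suc h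
    l = solve-∀
    r : ∀ s h k → s + suc k + suc h ≡ s + (suc h + suc k)
    r = solve-∀
view-above x z s (a , refl) (b , y≡) (c , z≡) 1≤s | tri> _ _ z<2s | g , 2s≡z+g | tri> _ _ x+z<g | h , g≡ | tri> _ _ x+2z<s with m<n⇒n≡m+1+k x+2z<s
... | w , refl = subst (λ y → View (x , y , z)) (rearrange x z (suc w)) (view₆ (2 * a) z (suc w))
  where
  rearrange : ∀ x z w → 2 * x + 2 * z + w ≡ x + (x + 2 * z + w)
  rearrange = solve-∀

view : ∀ x y z → Odd x → Odd y → Odd z → View (x , y , z)
view x y z odd-x@(a , x≡) odd-y odd-z with <-cmp (2 * y) x
... | tri≈ _ 2y≡x _ = contradiction (trans 2y≡x x≡) (even≢odd y a)
... | tri< 2y<x _ _ with m<n⇒n≡m+1+k 2y<x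
...   | t , refl = view₁ y z t
view x y z odd-x odd-y odd-z | tri> _ _ x<2y with <-cmp y x
... | tri≈ _ refl _ = view-diagonal x z
... | tri> _ _ x<y with m<n⇒n≡m+1+k x<y
...   | t , refl = view-above x z (suc t) odd-x odd-y odd-z (s≤s z≤n)
view x y z odd-x odd-y odd-z | tri> _ _ x<2y | tri< y<x _ _ with m<n⇒n≡m+1+k y<x
... | t , refl with m≤n⇒∃[o]m+o≡n (+-cancelˡ-≤ y (suc t) y (≤-trans (<⇒≤ x<2y) (≤-reflexive (cong (y +_) (+-identityʳ y)))))
...   | u , refl = subst (λ x → View (x , suc t + u , z)) (rearrange t u) (view₂ t u z)
  where
  rearrange : ∀ t u → 2 * suc t + u ≡ suc t + u + suc t
  rearrange = solve-∀

module OddSolutions (M : ℕ) (M≡3 : M % 8 ≡ 3) where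

  private
    w = M / 8

  M≡3+8w : M ≡ 3 + w * 8
  M≡3+8w = trans (m≡m%n+[m/n]*n M 8) (cong (_+ w * 8) M≡3)

  odd-x : ∀ {x y z} → IsSolution M (x , y , z) → Odd x
  odd-x {x} {y} {z} eq with even⊎odd x
  ... | inj₂ odd = odd
  ... | inj₁ (k , refl) = contradiction (trans (l k (y * z)) (trans eq (trans M≡3+8w (r w)))) (even≢odd (2 * (k * k) + y * z) (1 + 4 * w))
    where
    l : ∀ k p → 2 * (2 * (k * k) + p) ≡ 2 * k * (2 * k) + 2 * p
    l = solve-∀
    r : ∀ w → 3 + w * 8 ≡ suc (2 * (1 + 4 * w))
    r = solve-∀

  -- Modulo 4: x² is 1 and M is 3, so 2yz is 2.
  odd-product : ∀ {x y z} → IsSolution M (x , y , z) → Odd (y * z)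
  odd-product {x} {y} {z} eq with odd-x {x} {y} {z} eq | even⊎odd (y * z)
  ... | _ | inj₂ odd = odd
  ... | a , refl | inj₁ (k , yz≡2k) = contradiction
        (*-cancelˡ-≡ (2 * (a * a + a + k)) (suc (2 * (2 * w))) 2 (suc-injective (trans (l a k) (trans (cong (λ p → suc (2 * a) * suc (2 * a) + 2 * p) (sym yz≡2k)) (trans eq (trans M≡3+8w (r w)))))))
        (even≢odd (a * a + a + k) (2 * w))
    where
    l : ∀ a k → suc (2 * (2 * (a * a + a + k))) ≡ suc (2 * a) * suc (2 * a) + 2 * (2 * k)
    l = solve-∀
    r : ∀ w → 3 + w * 8 ≡ suc (2 * suc (2 * (2 * w)))
    r = solve-∀

odd-factorˡ : ∀ y z → Odd (y * z) → Odd y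
odd-factorˡ y z (k , yz≡) with even⊎odd y
... | inj₂ odd = odd
... | inj₁ (a , refl) = contradiction (trans (sym (*-assoc 2 a z)) yz≡) (even≢odd (a * z) k)

odd-factorʳ : ∀ y z → Odd (y * z) → Odd z
odd-factorʳ y z odd = odd-factorˡ z y (subst Odd (*-comm y z) odd)

-- One bundle for each solution, from which closure, involutivity and the absence of fixed points
-- are all read off.
IsPartner : ℕ → (Triple → Triple) → Triple → Triple → Set
IsPartner M f s s′ = f s ≡ s′ × IsSolution M s′ × f s′ ≡ s × s′ ≢ s

module JacksonInvolution (M : ℕ) (M≡3 : M % 8 ≡ 3) (δ : ℕ → ℕ → Triple)
  (δ-diagonal : ∀ x z → IsSolution M (x , x , z) →
    ∃ λ x′ → ∃ λ z′ → δ x z ≡ (x′ , x′ , z′) × IsSolution M (x′ , x′ , z′) × δ x′ z′ ≡ (x , x , z) × (x′ , x′ , z′) ≢ (x , x , z))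
  where

  open OddSolutions M M≡3
  open Jackson δ

  odd-y : ∀ {x y z} → IsSolution M (x , y , z) → Odd y
  odd-y {x} {y} {z} sol = odd-factorˡ y z (odd-product {x} {y} {z} sol)

  odd-z : ∀ {x y z} → IsSolution M (x , y , z) → Odd z
  odd-z {x} {y} {z} sol = odd-factorʳ y z (odd-product {x} {y} {z} sol)

  first : Triple → ℕ
  first = proj₁

  third : Triple → ℕ
  third = proj₂ ∘ proj₂

  partner : ∀ {s} → View s → IsSolution M s → ∃ (IsPartner M jackson s)
  partner (view₁ y z t) sol with odd-nonzero (odd-y {2 * y + suc t} {y} {z} sol)
  ... | y′ , refl = (suc t , z + (2 * suc t + 2 * y) , y) ,
    jackson₁ y z t ,
    trans (preserved y z (suc t)) sol ,
    trans (cong (λ b → jackson (suc t , b , y)) (+-comm z (2 * suc t + 2 * y))) (trans (jackson₆ t y z) (cong (λ a → a , y , z) (+-comm (suc t) (2 * y)))) ,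
    λ eq → m≢1+n+m (suc t) {y′ + (y + 0)} (cong first eq)
    where
    preserved : ∀ y z s → s * s + 2 * ((z + (2 * s + 2 * y)) * y) ≡ (2 * y + s) * (2 * y + s) + 2 * (y * z)
    preserved = solve-∀
  partner (view₂ t u z) sol with odd-nonzero (odd-z {2 * suc t + u} {suc t + u} {z} sol)
  ... | z′ , refl = (u , suc t + u , z + 2 * suc t) ,
    jackson₂ t u z ,
    trans (preserved (suc t) u z) sol ,
    jackson₃ t u z′ ,
    λ eq → m≢1+n+m u {t + (suc t + 0)} (cong first eq)
    where
    preserved : ∀ t u z → u * u + 2 * ((t + u) * (z + 2 * t)) ≡ (2 * t + u) * (2 * t + u) + 2 * ((t + u) * z)
    preserved = solve-∀
  partner (view-diagonal x z) sol with δ-diagonal x z sol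
  ... | x′ , z′ , δxz≡ , sol′ , δδ , ≢ = (x′ , x′ , z′) ,
    trans (jackson-diagonal x z) δxz≡ , sol′ , trans (jackson-diagonal x′ z′) δδ , ≢
  partner (view₃ t u r) sol = (2 * suc t + u , suc t + u , suc r) ,
    jackson₃ t u r ,
    trans (preserved (suc t) u (suc r)) sol ,
    jackson₂ t u (suc r) ,
    λ eq → m≢1+n+m u {t + (suc t + 0)} (sym (cong first eq))
    where
    preserved : ∀ t u r → (2 * t + u) * (2 * t + u) + 2 * ((t + u) * r) ≡ u * u + 2 * ((t + u) * (r + 2 * t))
    preserved = solve-∀
  partner (view₄ x y z g h y′ x+z≡ 2y≡ y+y′≡) sol with odd-x {x} {y} {z} sol | odd-z {x} {y} {z} sol | odd-y {x} {y} {z} sol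
  ... | a , refl | c , refl | b , y≡ = (suc h , y′ , suc g) ,
    jackson₄ x y z g h y′ x+z≡ 2y≡ y+y′≡ ,
    trans preserved sol ,
    jackson₄ (suc h) y′ (suc g) (2 * c) (2 * a) y h+g≡ 2y′≡ y′+y≡ ,
    λ eq → free (cong (proj₁ ∘ proj₂) eq)
    where
    h+g≡ : suc h + suc g ≡ z + x
    h+g≡ = trans (+-comm (suc h) (suc g)) (trans (sym x+z≡) (+-comm x z))
    y′+y≡ : y′ + y ≡ 2 * suc h + 2 * suc g
    y′+y≡ = trans (+-comm y′ y) (trans y+y′≡ (trans (sym (*-distribˡ-+ 2 x z)) (trans (cong (2 *_) (trans x+z≡ (+-comm (suc g) (suc h)))) (*-distribˡ-+ 2 (suc h) (suc g)))))
    2y′≡ : 2 * y′ ≡ 2 * suc h + suc g + z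
    2y′≡ = +-cancelˡ-≡ (2 * y) (2 * y′) (2 * suc h + suc g + z) (trans (sym (*-distribˡ-+ 2 y y′))
      (trans (cong (2 *_) y+y′≡) (trans (l x z) (trans (cong (λ s → 2 * x + 2 * z + 2 * s) x+z≡) (trans (r x z (suc g) (suc h)) (cong (_+ (2 * suc h + suc g + z)) (sym 2y≡)))))))
      where
      l : ∀ x z → 2 * (2 * x + 2 * z) ≡ 2 * x + 2 * z + 2 * (x + z)
      l = solve-∀
      r : ∀ x z g h → 2 * x + 2 * z + 2 * (g + h) ≡ 2 * x + z + g + (2 * h + g + z)
      r = solve-∀
    -- Branch 4 exchanges x with `suc h` and z with `suc g`. The right-hand side shows the
    -- invariance, since x + z and the product of g and z are unchanged.
    complete-square : ∀ x y z g → 2 * y ≡ 2 * x + z + g → x * x + 2 * (y * z) ≡ (x + z) * (x + z) + g * z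
    complete-square x y z g eq = trans (cong (x * x +_) (sym (*-assoc 2 y z))) (trans (cong (λ p → x * x + p * z) eq) (expand x z g))
      where
      expand : ∀ x z g → x * x + (2 * x + z + g) * z ≡ (x + z) * (x + z) + g * z
      expand = solve-∀
    preserved : suc h * suc h + 2 * (y′ * suc g) ≡ x * x + 2 * (y * z)
    preserved = trans (complete-square (suc h) y′ (suc g) z 2y′≡)
      (trans (cong₂ (λ s p → s * s + p) (trans h+g≡ (+-comm z x)) (*-comm z (suc g))) (sym (complete-square x y z (suc g) 2y≡)))
    -- A fixed y would be x + z, a sum of two odd numbers, but y is odd.
    free : y′ ≢ y
    free y′≡y = even≢odd (suc (a + c)) b (trans (*-cancelˡ-≡ (2 * suc (a + c)) y 2 (trans (l a c) (trans (sym y+y′≡) (trans (cong (y +_) y′≡y) (r y))))) y≡)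
      where
      l : ∀ a c → 2 * (2 * suc (a + c)) ≡ 2 * suc (2 * a) + 2 * suc (2 * c)
      l = solve-∀
      r : ∀ y → y + y ≡ 2 * y
      r = solve-∀
  partner (view₅ x z h k x+2z≡) sol with odd-z {x} {x + h + suc k} {z} sol
  ... | c , refl = (h , h + x + z , suc k) ,
    jackson₅ x z h k x+2z≡ ,
    trans preserved sol ,
    jackson₅ h (suc k) x (2 * c) (sym x+2z≡) ,
    free
    where
    -- Branch 5 exchanges (x, z) with (h, `suc k`). After adding h x both sides become (x + h) times
    -- the common value of x + 2z and h + 2 `suc k`, plus 2z `suc k`, which is symmetric.
    preserved : h * h + 2 * ((h + x + z) * suc k) ≡ x * x + 2 * ((x + h + suc k) * z)
    preserved = +-cancelˡ-≡ (h * x) _ _ (trans (l h x z (suc k)) (trans (cong (λ s → (x + h) * s + 2 * (z * suc k)) (sym x+2z≡)) (r h x z (suc k))))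
      where
      l : ∀ h x z k → h * x + (h * h + 2 * ((h + x + z) * k)) ≡ (x + h) * (h + 2 * k) + 2 * (z * k)
      l = solve-∀
      r : ∀ h x z k → (x + h) * (x + 2 * z) + 2 * (z * k) ≡ h * x + (x * x + 2 * ((x + h + k) * z))
      r = solve-∀
    -- A fixed point would give M + 8z² = (x + 2z)² + 6z², impossible modulo 8.
    free : (h , h + x + z , suc k) ≢ (x , x + h + suc k , z)
    free eq = avoids⇒≢ 1 6 3 (from-yes (avoids? 1 6 3)) M+8z²≡3 (x + 2 * z) z
      (trans (expand x z) (cong (_+ z * z * 8) (trans (cong₂ (λ h k → x * x + 2 * ((x + h + k) * z)) (sym (cong first eq)) (sym (cong third eq))) sol)))
      where
      M+8z²≡3 : (M + z * z * 8) % 8 ≡ 3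
      M+8z²≡3 = trans ([m+kn]%n≡m%n M (z * z) 8) M≡3
      expand : ∀ x z → 1 * ((x + 2 * z) * (x + 2 * z)) + 6 * (z * z) ≡ x * x + 2 * ((x + x + z) * z) + z * z * 8
      expand = solve-∀
  partner (view₆ x z w) sol with odd-nonzero (odd-z {suc x} {2 * suc x + 2 * z + w} {z} sol)
  ... | z′ , refl = (suc x + 2 * z , z , w) ,
    jackson₆ x z w ,
    trans (preserved (suc x) z w) sol ,
    trans (cong (λ a → jackson (a , z , w)) (+-comm (suc x) (2 * z))) (trans (jackson₁ z w x) (cong (λ b → suc x , b , z) (+-comm w (2 * suc x + 2 * z)))) ,
    λ eq → m≢1+m+n (suc x) {z′ + (z + 0)} (sym (trans (sym (+-suc (suc x) (z′ + (z + 0)))) (cong first eq)))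
    where
    preserved : ∀ x z w → (x + 2 * z) * (x + 2 * z) + 2 * (z * w) ≡ x * x + 2 * ((2 * x + 2 * z + w) * z)
    preserved = solve-∀

-- Divisors of a product of coprime numbers

coprime-∣ˡ : ∀ {k m n} → k ∣ m → Coprime m n → Coprime k n
coprime-∣ˡ k∣m coprime (d∣k , d∣n) = coprime (∣-trans d∣k k∣m , d∣n)

coprime-*ʳ : ∀ {k m n} → Coprime k m → Coprime k n → Coprime k (m * n)
coprime-*ʳ c₁ c₂ (d∣k , d∣mn) = c₂ (d∣k , coprime-divisor (coprime-∣ˡ d∣k c₁) d∣mn)

gcd-of-product : ∀ {P m u e} → Coprime P m → u ∣ P → e ∣ m → gcd (u * e) P ≡ u
gcd-of-product {P} {m} {u} {e} coprime u∣P e∣m = ∣-antisym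
  (coprime-divisor (coprime-∣ˡ (gcd[m,n]∣n (u * e) P) (Coprimality.sym (coprime-∣ˡ e∣m (Coprimality.sym coprime))))
    (subst (gcd (u * e) P ∣_) (*-comm u e) (gcd[m,n]∣m (u * e) P)))
  (gcd-greatest (m∣m*n e) u∣P)

module _ (P m : ℕ) (coprime : Coprime P m) where

  -- With u and e the two gcds: u and e are coprime divisors of d, so u e divides d. Conversely d
  -- divides m d and m P, hence m u, and then u d and u m, hence u e.
  gcd*gcd : ∀ d d′ → d * d′ ≡ P * m → gcd d P * gcd d m ≡ d
  gcd*gcd d d′ dd′≡Pm with gcd[m,n]∣m d m
  ... | divides b d≡b*e = ∣-antisym u*e∣d d∣u*e
    where
    u = gcd d P
    e = gcd d m
    coprime-u-e : Coprime u e
    coprime-u-e = coprime-∣ˡ (gcd[m,n]∣n d P) (Coprimality.sym (coprime-∣ˡ (gcd[m,n]∣n d m) (Coprimality.sym coprime)))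
    u∣b : u ∣ b
    u∣b = coprime-divisor coprime-u-e (subst (u ∣_) (trans d≡b*e (*-comm b e)) (gcd[m,n]∣m d P))
    u*e∣d : u * e ∣ d
    u*e∣d = subst (u * e ∣_) (sym d≡b*e) (*-monoˡ-∣ e u∣b)
    d∣u*e : d ∣ u * e
    d∣u*e = subst (d ∣_) (sym (c*gcd[m,n]≡gcd[cm,cn] u d m)) (gcd-greatest (n∣m*n u) d∣u*m)
      where
      d∣u*m : d ∣ u * m
      d∣u*m = subst (d ∣_) (trans (sym (c*gcd[m,n]≡gcd[cm,cn] m d P)) (*-comm m u))
        (gcd-greatest (n∣m*n m) (subst (d ∣_) (trans dd′≡Pm (*-comm P m)) (m∣m*n d′)))

  -- Multiplying `gcd*gcd` for d and d' gives P m. The factors taken from P are coprime to m and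
  -- those taken from m are coprime to P, so the product splits accordingly.
  gcd-complementary : ∀ d d′ → d * d′ ≡ P * m → gcd d P * gcd d′ P ≡ P
  gcd-complementary d d′ dd′≡Pm = ∣-antisym
    (coprime-divisor (Coprimality.sym (coprime-*ʳ (coprime-gcd d) (coprime-gcd d′)))
      (subst (gcd d P * gcd d′ P ∣_) (trans product (*-comm P m)) (m∣m*n (gcd d m * gcd d′ m))))
    (coprime-divisor (coprime-*ʳ (coprime-gcd′ d) (coprime-gcd′ d′))
      (subst (P ∣_) (trans (sym product) (*-comm (gcd d P * gcd d′ P) (gcd d m * gcd d′ m))) (m∣m*n m)))
    where
    coprime-gcd : ∀ d → Coprime m (gcd d P)
    coprime-gcd d = Coprimality.sym (coprime-∣ˡ (gcd[m,n]∣n d P) coprime)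
    coprime-gcd′ : ∀ d → Coprime P (gcd d m)
    coprime-gcd′ d = Coprimality.sym (coprime-∣ˡ (gcd[m,n]∣n d m) (Coprimality.sym coprime))
    product : gcd d P * gcd d′ P * (gcd d m * gcd d′ m) ≡ P * m
    product = trans (regroup (gcd d P) (gcd d′ P) (gcd d m) (gcd d′ m))
      (trans (cong₂ _*_ (gcd*gcd d d′ dd′≡Pm) (gcd*gcd d′ d (trans (*-comm d′ d) dd′≡Pm))) dd′≡Pm)
      where
      regroup : ∀ a b c d → a * b * (c * d) ≡ a * c * (b * d)
      regroup = solve-∀

-- d ↦ exchange d d′ replaces the part of the divisor d dividing m by its
-- complement and keeps the part dividing P.
module Exchange (P m : ℕ) (coprime : Coprime P m) where

  exchange : ℕ → ℕ → ℕ
  exchange d d′ = gcd d P * gcd d′ m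

  module _ (d d′ : ℕ) (dd′≡Pm : d * d′ ≡ P * m) where

    private
      d′d≡Pm : d′ * d ≡ P * m
      d′d≡Pm = trans (*-comm d′ d) dd′≡Pm

    exchange-product : exchange d d′ * exchange d′ d ≡ P * m
    exchange-product = trans (regroup (gcd d P) (gcd d′ m) (gcd d′ P) (gcd d m))
      (trans (cong₂ _*_ (gcd*gcd P m coprime d d′ dd′≡Pm) (gcd*gcd P m coprime d′ d d′d≡Pm)) dd′≡Pm)
      where
      regroup : ∀ a b c d → a * b * (c * d) ≡ a * d * (c * b)
      regroup = solve-∀

    exchange-involutive : exchange (exchange d d′) (exchange d′ d) ≡ d
    exchange-involutive = trans (cong₂ _*_
      (gcd-of-product coprime (gcd[m,n]∣n d P) (gcd[m,n]∣n d′ m))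
      (trans (cong (λ n → gcd n m) (*-comm (gcd d′ P) (gcd d m)))
             (gcd-of-product (Coprimality.sym coprime) (gcd[m,n]∣n d m) (gcd[m,n]∣n d′ P))))
      (gcd*gcd P m coprime d d′ dd′≡Pm)

    -- If d is fixed, d and d' have the same m-part; the two parts multiply to m, which would be a
    -- square.
    exchange≢ˡ : NonZero d → (∀ a → a * a ≢ m) → exchange d d′ ≢ d
    exchange≢ˡ d≢0 m-nonsquare eq = m-nonsquare (gcd d m) (trans (cong (gcd d m *_) (sym e′≡e)) (gcd-complementary m P (Coprimality.sym coprime) d d′ (trans dd′≡Pm (*-comm P m))))
      where
      gcd*gcd≡d = gcd*gcd P m coprime d d′ dd′≡Pm
      e′≡e : gcd d′ m ≡ gcd d m
      e′≡e = *-cancelˡ-≡ (gcd d′ m) (gcd d m) (gcd d P)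
        {{m*n≢0⇒m≢0 (gcd d P) {{subst NonZero (sym gcd*gcd≡d) d≢0}}}} (trans eq (sym gcd*gcd≡d))

    -- Mapping d to d' would fix the unordered factorization as well. It forces equal P-parts, whose
    -- product is P.
    exchange≢ʳ : NonZero d′ → (∀ a → a * a ≢ P) → exchange d d′ ≢ d′
    exchange≢ʳ d′≢0 P-nonsquare eq = P-nonsquare (gcd d P) (trans (cong (gcd d P *_) u≡u′) (gcd-complementary P m coprime d d′ dd′≡Pm))
      where
      gcd*gcd≡d′ = gcd*gcd P m coprime d′ d d′d≡Pm
      u≡u′ : gcd d P ≡ gcd d′ P
      u≡u′ = *-cancelʳ-≡ (gcd d P) (gcd d′ P) (gcd d′ m)
        {{m*n≢0⇒n≢0 (gcd d′ P) {{subst NonZero (sym gcd*gcd≡d′) d′≢0}}}} (trans eq (sym gcd*gcd≡d′))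

-- The involution on factorizations

abstract
  -- For distinct odd g and h this is the solution (x, x, z) whose factors x and x + 2z are g and h
  -- in increasing order.
  diagonal : ℕ → ℕ → Triple
  diagonal g h = if g <ᵇ h then (g , g , ⌊ h ∸ g /2⌋) else (h , h , ⌊ g ∸ h /2⌋)

  ⌊2n/2⌋ : ∀ n → ⌊ 2 * n /2⌋ ≡ n
  ⌊2n/2⌋ n = trans (cong (λ k → ⌊ n + k /2⌋) (+-identityʳ n)) (sym (n≡⌊n+n/2⌋ n))

  diagonal-< : ∀ r s → diagonal r (r + 2 * suc s) ≡ (r , r , suc s)
  diagonal-< r s rewrite <ᵇ-true {r} {r + 2 * suc s} (s + (suc s + 0)) refl | m+n∸m≡n r (2 * suc s) | ⌊2n/2⌋ (suc s) = refl

  diagonal-> : ∀ r s → diagonal (r + 2 * suc s) r ≡ (r , r , suc s)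
  diagonal-> r s rewrite <ᵇ-false {r + 2 * suc s} {r} (2 * suc s) refl | m+n∸m≡n r (2 * suc s) | ⌊2n/2⌋ (suc s) = refl

odd-gap : ∀ {g h} → Odd g → Odd h → g < h → ∃ λ s → h ≡ g + 2 * suc s
odd-gap {g} (a , refl) (b , h≡) g<h with m<n⇒n≡m+1+k g<h
... | k , refl with even⊎odd (suc k)
...   | inj₁ (suc s , eq) = s , cong (g +_) eq
...   | inj₂ (c , eq) = contradiction (trans (rearrange a c) (trans (cong (suc (2 * a) +_) (sym eq)) h≡)) (even≢odd (suc (a + c)) b)
  where
  rearrange : ∀ a c → 2 * suc (a + c) ≡ suc (2 * a) + suc (2 * c)
  rearrange = solve-∀

module DiagonalInvolution (M : ℕ) (M≡3 : M % 8 ≡ 3) (τ : ℕ → ℕ → ℕ)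
  (τ-product : ∀ d d′ → d * d′ ≡ M → τ d d′ * τ d′ d ≡ M)
  (τ-involutive : ∀ d d′ → d * d′ ≡ M → τ (τ d d′) (τ d′ d) ≡ d)
  (τ≢ˡ : ∀ d d′ → d * d′ ≡ M → NonZero d → τ d d′ ≢ d)
  (τ≢ʳ : ∀ d d′ → d * d′ ≡ M → NonZero d′ → τ d d′ ≢ d′)
  where

  open OddSolutions M M≡3

  δ : ℕ → ℕ → Triple
  δ x z = diagonal (τ x (x + 2 * z)) (τ (x + 2 * z) x)

  solution⇒factorization : ∀ {x z} → IsSolution M (x , x , z) → x * (x + 2 * z) ≡ M
  solution⇒factorization {x} {z} sol = trans (expand x z) sol
    where
    expand : ∀ x z → x * (x + 2 * z) ≡ x * x + 2 * (x * z)
    expand = solve-∀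

  factorization⇒solution : ∀ {x z} → x * (x + 2 * z) ≡ M → IsSolution M (x , x , z)
  factorization⇒solution {x} {z} eq = trans (expand x z) eq
    where
    expand : ∀ x z → x * x + 2 * (x * z) ≡ x * (x + 2 * z)
    expand = solve-∀

  M-odd : Odd M
  M-odd = 1 + 4 * (M / 8) , trans M≡3+8w (rearrange (M / 8))
    where
    rearrange : ∀ w → 3 + w * 8 ≡ suc (2 * (1 + 4 * w))
    rearrange = solve-∀

  M-nonsquare : ∀ a → a * a ≢ M
  M-nonsquare a eq = avoids⇒≢ 1 0 3 (from-yes (avoids? 1 0 3)) M≡3 a 0 (trans (+-identityʳ (1 * (a * a))) (trans (*-identityˡ (a * a)) eq))

  δ-diagonal : ∀ x z → IsSolution M (x , x , z) →
    ∃ λ x′ → ∃ λ z′ → δ x z ≡ (x′ , x′ , z′) × IsSolution M (x′ , x′ , z′) × δ x′ z′ ≡ (x , x , z) × (x′ , x′ , z′) ≢ (x , x , z)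
  δ-diagonal x zero sol with odd-factorʳ x 0 (odd-product {x} {x} {0} sol)
  ... | _ , ()
  δ-diagonal x z@(suc z₀) sol = by-cases (<-cmp g h)
    where
    d = x
    d′ = x + 2 * z
    g = τ d d′
    h = τ d′ d
    dd′≡M = solution⇒factorization {x} {z} sol
    gh≡M : g * h ≡ M
    gh≡M = τ-product d d′ dd′≡M
    d′d≡M : d′ * d ≡ M
    d′d≡M = trans (*-comm d′ d) dd′≡M
    odd-g : Odd g
    odd-g = odd-factorˡ g h (subst Odd (sym gh≡M) M-odd)
    odd-h : Odd h
    odd-h = odd-factorʳ g h (subst Odd (sym gh≡M) M-odd)
    d≢0 : NonZero d
    d≢0 with odd-factorˡ d d′ (subst Odd (sym dd′≡M) M-odd)
    ... | k , refl = _
    by-cases : _ → ∃ λ x′ → ∃ λ z′ → δ x z ≡ (x′ , x′ , z′) × IsSolution M (x′ , x′ , z′) × δ x′ z′ ≡ (x , x , z) × (x′ , x′ , z′) ≢ (x , x , z)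
    by-cases (tri≈ _ g≡h _) = contradiction (trans (cong (g *_) g≡h) gh≡M) (M-nonsquare g)
    by-cases (tri< g<h _ _) with odd-gap odd-g odd-h g<h
    ... | s , h≡ = g , suc s ,
      trans (cong (diagonal g) h≡) (diagonal-< g s) ,
      factorization⇒solution {g} {suc s} (trans (cong (g *_) (sym h≡)) gh≡M) ,
      trans (cong (λ n → diagonal (τ g n) (τ n g)) (sym h≡))
        (trans (cong₂ diagonal (τ-involutive d d′ dd′≡M) (τ-involutive d′ d d′d≡M)) (diagonal-< x z₀)) ,
      λ eq → τ≢ˡ d d′ dd′≡M d≢0 (cong proj₁ eq)
    -- The exchange has reversed the order of the factors. Applied again it returns d' before d,
    -- which `diagonal` sorts back.
    by-cases (tri> _ _ h<g) with odd-gap odd-h odd-g h<g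
    ... | s , g≡ = h , suc s ,
      trans (cong (λ n → diagonal n h) g≡) (diagonal-> h s) ,
      factorization⇒solution {h} {suc s} (trans (cong (h *_) (sym g≡)) (trans (*-comm h g) gh≡M)) ,
      trans (cong (λ n → diagonal (τ h n) (τ n h)) (sym g≡))
        (trans (cong₂ diagonal (τ-involutive d′ d d′d≡M) (τ-involutive d d′ dd′≡M)) (diagonal-> x z₀)) ,
      λ eq → τ≢ʳ d′ d d′d≡M d≢0 (cong proj₁ eq)

-- From x² + 2yz to x² + 2y²

module Representations (M : ℕ) (M≡3 : M % 8 ≡ 3) (δ : ℕ → ℕ → Triple)
  (δ-diagonal : ∀ x z → IsSolution M (x , x , z) →
    ∃ λ x′ → ∃ λ z′ → δ x z ≡ (x′ , x′ , z′) × IsSolution M (x′ , x′ , z′) × δ x′ z′ ≡ (x , x , z) × (x′ , x′ , z′) ≢ (x , x , z))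
  where

  open OddSolutions M M≡3
  open Jackson δ using (jackson)
  open JacksonInvolution M M≡3 δ δ-diagonal

  isSolution? : ∀ s → Dec (IsSolution M s)
  isSolution? (x , y , z) = x * x + 2 * (y * z) ≟ M

  range : List ℕ
  range = upTo (suc M)

  solutions : List Triple
  solutions = filter isSolution? (cartesianProduct range (cartesianProduct range range))

  ∈-solutions⁻ : ∀ {s} → s ∈ solutions → IsSolution M s
  ∈-solutions⁻ s∈ = proj₂ (∈-filter⁻ isSolution? {xs = cartesianProduct range (cartesianProduct range range)} s∈)

  x-nonzero : ∀ {x y z} → IsSolution M (x , y , z) → NonZero x
  x-nonzero {x} {y} {z} sol with odd-x {x} {y} {z} sol
  ... | k , refl = _

  y-nonzero : ∀ {x y z} → IsSolution M (x , y , z) → NonZero y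
  y-nonzero {x} {y} {z} sol with odd-y {x} {y} {z} sol
  ... | k , refl = _

  z-nonzero : ∀ {x y z} → IsSolution M (x , y , z) → NonZero z
  z-nonzero {x} {y} {z} sol with odd-z {x} {y} {z} sol
  ... | k , refl = _

  x≤M : ∀ {x y z} → IsSolution M (x , y , z) → x ≤ M
  x≤M {x} {y} {z} sol = ≤-trans (m≤m*n x x {{x-nonzero {x} {y} {z} sol}}) (≤-trans (m≤m+n (x * x) (2 * (y * z))) (≤-reflexive sol))

  yz≤M : ∀ {x y z} → IsSolution M (x , y , z) → y * z ≤ M
  yz≤M {x} {y} {z} sol = ≤-trans (m≤n*m (y * z) 2) (≤-trans (m≤n+m (2 * (y * z)) (x * x)) (≤-reflexive sol))

  y≤M : ∀ {x y z} → IsSolution M (x , y , z) → y ≤ M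
  y≤M {x} {y} {z} sol = ≤-trans (m≤m*n y z {{z-nonzero {x} {y} {z} sol}}) (yz≤M {x} {y} {z} sol)

  z≤M : ∀ {x y z} → IsSolution M (x , y , z) → z ≤ M
  z≤M {x} {y} {z} sol = ≤-trans (m≤n*m z y {{y-nonzero {x} {y} {z} sol}}) (yz≤M {x} {y} {z} sol)

  -- Oddness makes all coordinates nonzero, so none exceeds M and the finite search misses no
  -- solution.
  ∈-solutions⁺ : ∀ {s} → IsSolution M s → s ∈ solutions
  ∈-solutions⁺ {x , y , z} sol = ∈-filter⁺ isSolution?
    (∈-cartesianProduct⁺ (∈-upTo⁺ (s≤s (x≤M {x} {y} {z} sol)))
      (∈-cartesianProduct⁺ (∈-upTo⁺ (s≤s (y≤M {x} {y} {z} sol))) (∈-upTo⁺ (s≤s (z≤M {x} {y} {z} sol))))) sol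

  solutions-unique : Unique solutions
  solutions-unique = Uniqueₚ.filter⁺ isSolution?
    (Uniqueₚ.cartesianProduct⁺ (Uniqueₚ.upTo⁺ (suc M)) (Uniqueₚ.cartesianProduct⁺ (Uniqueₚ.upTo⁺ (suc M)) (Uniqueₚ.upTo⁺ (suc M))))

  solution-partner : ∀ {s} → s ∈ solutions → ∃ (IsPartner M jackson s)
  solution-partner {x , y , z} s∈ = partner (view x y z (odd-x {x} {y} {z} sol) (odd-y {x} {y} {z} sol) (odd-z {x} {y} {z} sol)) sol
    where
    sol = ∈-solutions⁻ s∈

  even-solutions : 2 ∣ length solutions
  even-solutions = even-length-by-involution jackson solutions solutions-unique closed involutive free
    where
    closed : ∀ {s} → s ∈ solutions → jackson s ∈ solutions
    closed s∈ with solution-partner s∈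
    ... | s′ , js≡ , sol′ , _ = subst (_∈ solutions) (sym js≡) (∈-solutions⁺ sol′)
    involutive : ∀ {s} → s ∈ solutions → jackson (jackson s) ≡ s
    involutive s∈ with solution-partner s∈
    ... | s′ , js≡ , _ , js′≡ , _ = trans (cong jackson js≡) js′≡
    free : ∀ {s} → s ∈ solutions → jackson s ≢ s
    free s∈ eq with solution-partner s∈
    ... | s′ , js≡ , _ , _ , s′≢s = s′≢s (trans (sym js≡) eq)

  -- The solutions fixed by the exchange of y and z, listed in any way, are as many modulo 2 as all solutions.
  module _ {A : Set} (F : List A) (F-unique : Unique F) (X Y : A → ℕ) (encode : ℕ → ℕ → A)
    (F-sound : ∀ {a} → a ∈ F → IsSolution M (X a , Y a , Y a))
    (F-complete : ∀ {x y} → IsSolution M (x , y , y) → encode x y ∈ F)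
    (encode-XY : ∀ {a} → a ∈ F → encode (X a) (Y a) ≡ a)
    (XY-encode : ∀ {x y} → IsSolution M (x , y , y) → (X (encode x y) , Y (encode x y)) ≡ (x , y))
    where

    -- A solution with y = z is paired with its entry in F instead of being fixed. The union of
    -- solutions and F then carries an involution without fixed points, and its length is even.
    swap-yz : Triple ⊎ A → Triple ⊎ A
    swap-yz (inj₁ (x , y , z)) with y ≟ z
    ... | yes _ = inj₂ (encode x y)
    ... | no  _ = inj₁ (x , z , y)
    swap-yz (inj₂ a) = inj₁ (X a , Y a , Y a)

    swap-≢ : ∀ {x y z} → y ≢ z → swap-yz (inj₁ (x , y , z)) ≡ inj₁ (x , z , y)
    swap-≢ {x} {y} {z} y≢z with y ≟ z
    ... | yes y≡z = contradiction y≡z y≢z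
    ... | no  _   = refl

    swap-≡ : ∀ x y → swap-yz (inj₁ (x , y , y)) ≡ inj₂ (encode x y)
    swap-≡ x y with y ≟ y
    ... | yes _   = refl
    ... | no  y≢y = contradiction refl y≢y

    all : List (Triple ⊎ A)
    all = map inj₁ solutions ++ map inj₂ F

    ∈-all₁ : ∀ {s} → IsSolution M s → inj₁ s ∈ all
    ∈-all₁ sol = ∈-++⁺ˡ (∈-map⁺ inj₁ (∈-solutions⁺ sol))

    ∈-all₂ : ∀ {a} → a ∈ F → inj₂ a ∈ all
    ∈-all₂ a∈ = ∈-++⁺ʳ (map inj₁ solutions) (∈-map⁺ inj₂ a∈)

    ∈-all⁻ : ∀ {e} → e ∈ all → (∃ λ s → e ≡ inj₁ s × IsSolution M s) ⊎ (∃ λ a → e ≡ inj₂ a × a ∈ F)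
    ∈-all⁻ e∈ with ∈-++⁻ (map inj₁ solutions) e∈
    ... | inj₁ e∈₁ with ∈-map⁻ inj₁ e∈₁
    ...   | s , s∈ , e≡ = inj₁ (s , e≡ , ∈-solutions⁻ s∈)
    ∈-all⁻ e∈ | inj₂ e∈₂ with ∈-map⁻ inj₂ e∈₂
    ...   | a , a∈ , e≡ = inj₂ (a , e≡ , a∈)

    all-unique : Unique all
    all-unique = Uniqueₚ.++⁺ (Uniqueₚ.map⁺ inj₁-injective solutions-unique) (Uniqueₚ.map⁺ inj₂-injective F-unique) disjoint
      where
      disjoint : ∀ {e} → ¬ (e ∈ map inj₁ solutions × e ∈ map inj₂ F)
      disjoint (e∈₁ , e∈₂) with ∈-map⁻ inj₁ e∈₁ | ∈-map⁻ inj₂ e∈₂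
      ... | _ , _ , refl | _ , _ , ()

    swap-solution : ∀ {x y z} → IsSolution M (x , y , z) → IsSolution M (x , z , y)
    swap-solution {x} {y} {z} sol = trans (cong (λ p → x * x + 2 * p) (*-comm z y)) sol

    even-fixed : 2 ∣ length F
    even-fixed = ∣m+n∣m⇒∣n (subst (2 ∣_) length-all (even-length-by-involution swap-yz all all-unique closed involutive free)) even-solutions
      where
      length-all : length all ≡ length solutions + length F
      length-all = trans (Listₚ.length-++ (map inj₁ solutions)) (cong₂ _+_ (Listₚ.length-map inj₁ solutions) (Listₚ.length-map inj₂ F))
      closed : ∀ {e} → e ∈ all → swap-yz e ∈ all
      closed e∈ with ∈-all⁻ e∈
      ... | inj₂ (a , refl , a∈) = ∈-all₁ (F-sound a∈)
      ... | inj₁ ((x , y , z) , refl , sol) with y ≟ z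
      ...   | yes refl = ∈-all₂ (F-complete sol)
      ...   | no  _    = ∈-all₁ (swap-solution {x} {y} {z} sol)
      involutive : ∀ {e} → e ∈ all → swap-yz (swap-yz e) ≡ e
      involutive e∈ with ∈-all⁻ e∈
      ... | inj₂ (a , refl , a∈) = trans (swap-≡ (X a) (Y a)) (cong inj₂ (encode-XY a∈))
      ... | inj₁ ((x , y , z) , refl , sol) with y ≟ z
      ...   | yes refl = cong (λ (x , y) → inj₁ (x , y , y)) (XY-encode sol)
      ...   | no  y≢z  = swap-≢ (y≢z ∘ sym)
      free : ∀ {e} → e ∈ all → swap-yz e ≢ e
      free e∈ with ∈-all⁻ e∈
      ... | inj₂ (a , refl , a∈) = λ ()
      ... | inj₁ ((x , y , z) , refl , sol) with y ≟ z
      ...   | yes refl = λ ()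
      ...   | no  y≢z  = λ eq → y≢z (cong (proj₂ ∘ proj₂) (inj₁-injective eq))

-- The two representation numbers for N = 2M

3-mod-4⇒3∨7-mod-8 : ∀ {n} → n % 4 ≡ 3 → n % 8 ≡ 3 ⊎ n % 8 ≡ 7
3-mod-4⇒3∨7-mod-8 {n} n≡3 with even⊎odd (n / 4) | trans (m≡m%n+[m/n]*n n 4) (cong (_+ n / 4 * 4) n≡3)
... | inj₁ (k , q≡) | n≡ = inj₁ (trans (cong (_% 8) (trans n≡ (trans (cong (λ q → 3 + q * 4) q≡) (expand k)))) ([m+kn]%n≡m%n 3 k 8))
  where
  expand : ∀ k → 3 + 2 * k * 4 ≡ 3 + k * 8
  expand = solve-∀
... | inj₂ (k , q≡) | n≡ = inj₂ (trans (cong (_% 8) (trans n≡ (trans (cong (λ q → 3 + q * 4) q≡) (expand k)))) ([m+kn]%n≡m%n 7 k 8))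
  where
  expand : ∀ k → 3 + suc (2 * k) * 4 ≡ 7 + k * 8
  expand = solve-∀

3-mod-4⇒nonsquare : ∀ {n} → n % 4 ≡ 3 → ∀ a → a * a ≢ n
3-mod-4⇒nonsquare {n} n≡3 a a²≡n with 3-mod-4⇒3∨7-mod-8 {n} n≡3
... | inj₁ n≡3 = avoids⇒≢ 1 0 3 (from-yes (avoids? 1 0 3)) n≡3 a 0 (trans (+-identityʳ (1 * (a * a))) (trans (*-identityˡ (a * a)) a²≡n))
... | inj₂ n≡7 = avoids⇒≢ 1 0 7 (from-yes (avoids? 1 0 7)) n≡7 a 0 (trans (+-identityʳ (1 * (a * a))) (trans (*-identityˡ (a * a)) a²≡n))

empty⇒length≡0 : ∀ {A : Set} {xs : List A} → (∀ {x} → ¬ x ∈ xs) → length xs ≡ 0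
empty⇒length≡0 {xs = []}     none = refl
empty⇒length≡0 {xs = x ∷ xs} none = contradiction (here refl) none

module EvenRepresentations (P m : ℕ) (coprime : Coprime P m) (P-nonsquare : ∀ a → a * a ≢ P) (m-nonsquare : ∀ a → a * a ≢ m)
  (Pm≡3 : (P * m) % 4 ≡ 3) where

  private
    M N : ℕ
    M = P * m
    N = M + M

  module _ {F : List (ℕ × ℕ)} (F-unique : Unique F) (X Y : ℕ × ℕ → ℕ) (encode : ℕ → ℕ → ℕ × ℕ)
    (F-sound : ∀ {a} → a ∈ F → IsSolution M (X a , Y a , Y a))
    (F-complete : ∀ {x y} → NonZero x → NonZero y → x ≤ M → y ≤ M → IsSolution M (x , y , y) → encode x y ∈ F)
    (encode-XY : ∀ {a} → a ∈ F → encode (X a) (Y a) ≡ a)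
    (XY-encode : ∀ {x y} → NonZero x → NonZero y → (X (encode x y) , Y (encode x y)) ≡ (x , y))
    where

    -- One statement for the forms x² + 2y² = 2M and 2x² + 4y² = 2M: `X` and `Y` extract from a pair
    -- of indices the representation of M that it codes.
    even-length : 2 ∣ length F
    even-length with 3-mod-4⇒3∨7-mod-8 {M} Pm≡3
    ... | inj₂ M≡7 = subst (2 ∣_) (sym (empty⇒length≡0 λ {a} a∈ → avoids⇒≢ 1 2 7 (from-yes (avoids? 1 2 7)) M≡7 (X a) (Y a)
                        (trans (cong (_+ 2 * (Y a * Y a)) (*-identityˡ (X a * X a))) (F-sound a∈)))) (2 ∣0)
    ... | inj₁ M≡3 = R.even-fixed F F-unique X Y encode F-sound
        (λ {x} {y} sol → F-complete (R.x-nonzero {x} {y} {y} sol) (R.y-nonzero {x} {y} {y} sol) (R.x≤M {x} {y} {y} sol) (R.y≤M {x} {y} {y} sol) sol) encode-XY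
        (λ {x} {y} sol → XY-encode (R.x-nonzero {x} {y} {y} sol) (R.y-nonzero {x} {y} {y} sol))
      where
      open Exchange P m coprime
      module D = DiagonalInvolution M M≡3 exchange exchange-product exchange-involutive
        (λ d d′ eq d≢0 → exchange≢ˡ d d′ eq d≢0 m-nonsquare) (λ d d′ eq d′≢0 → exchange≢ʳ d d′ eq d′≢0 P-nonsquare)
      module R = Representations M M≡3 D.δ D.δ-diagonal

  pairs : List (ℕ × ℕ)
  pairs = cartesianProduct (downFrom N) (downFrom N)

  pairs-unique : Unique pairs
  pairs-unique = Uniqueₚ.cartesianProduct⁺ (Uniqueₚ.downFrom⁺ N) (Uniqueₚ.downFrom⁺ N)

  module _ (a b : ℕ) where

    represents? : ∀ ((i , j) : ℕ × ℕ) → Dec (a * (suc i * suc i) + b * (suc j * suc j) ≡ N)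
    represents? (i , j) = a * (suc i * suc i) + b * (suc j * suc j) ≟ N

    ∈⁻ : ∀ {(i , j) : ℕ × ℕ} → (i , j) ∈ filter represents? pairs → a * (suc i * suc i) + b * (suc j * suc j) ≡ N
    ∈⁻ = proj₂ ∘ ∈-filter⁻ represents? {xs = pairs}

    ∈⁺ : ∀ {x y} → NonZero x → NonZero y → x ≤ N → y ≤ N → a * (x * x) + b * (y * y) ≡ N → (pred x , pred y) ∈ filter represents? pairs
    ∈⁺ {suc i} {suc j} _ _ i<N j<N eq = ∈-filter⁺ represents? (∈-cartesianProduct⁺ (∈-downFrom⁺ i<N) (∈-downFrom⁺ j<N)) eq

  ≤N : ∀ {x} → x ≤ M → x ≤ N
  ≤N x≤M = ≤-trans x≤M (m≤m+n M M)

  2M≡N : 2 * M ≡ N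
  2M≡N = cong (M +_) (+-identityʳ M)

  -- Halving 2x² + 4y² = 2M gives a representation of M in the same variables.
  even₂₄ : 2 ∣ Truncation.representations N 2 4
  even₂₄ = even-length (Uniqueₚ.filter⁺ (represents? 2 4) pairs-unique) (suc ∘ proj₁) (suc ∘ proj₂) (λ x y → pred x , pred y)
    (λ {(i , j)} a∈ → *-cancelˡ-≡ _ M 2 (trans (expand (suc i) (suc j)) (trans (∈⁻ 2 4 a∈) (sym 2M≡N))))
    (λ {x} {y} x≢0 y≢0 x≤M y≤M sol → ∈⁺ 2 4 x≢0 y≢0 (≤N x≤M) (≤N y≤M) (trans (sym (expand x y)) (trans (cong (2 *_) sol) 2M≡N)))
    (λ _ → refl)
    (λ { {suc x} {suc y} _ _ → refl })
    where
    expand : ∀ x y → 2 * (x * x + 2 * (y * y)) ≡ 2 * (x * x) + 4 * (y * y)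
    expand = solve-∀

  -- In x² + 2y² = 2M the number x is even, and x = 2u gives M = y² + 2u²; hence the exchanged roles
  -- and the halving in the decoding.
  even₁₂ : 2 ∣ Truncation.representations N 1 2
  even₁₂ = even-length (Uniqueₚ.filter⁺ (represents? 1 2) pairs-unique) (suc ∘ proj₂) (λ (i , _) → ⌊ suc i /2⌋) (λ x y → pred (2 * y) , pred x)
    sound complete inverse
    (λ { {suc x} {suc y} _ _ → cong (suc x ,_) (⌊2n/2⌋ (suc y)) })
    where
    expand : ∀ x y → 2 * (x * x + 2 * (y * y)) ≡ 1 * (2 * y * (2 * y)) + 2 * (x * x)
    expand = solve-∀
    half : ∀ {i j} → 1 * (suc i * suc i) + 2 * (suc j * suc j) ≡ N → ∃ λ k → suc i ≡ 2 * k
    half {i} {j} eq with even⊎odd (suc i)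
    ... | inj₁ even = even
    ... | inj₂ (k , suc-i≡) = contradiction (trans 2M≡N (trans (sym eq) (trans (cong (λ s → 1 * (s * s) + 2 * (suc j * suc j)) suc-i≡) (odd-square k (suc j * suc j)))))
            (even≢odd M (2 * (k * k) + 2 * k + suc j * suc j))
      where
      odd-square : ∀ k q → 1 * (suc (2 * k) * suc (2 * k)) + 2 * q ≡ suc (2 * (2 * (k * k) + 2 * k + q))
      odd-square = solve-∀
    F = filter (represents? 1 2) pairs
    sound : ∀ {(i , j) : ℕ × ℕ} → (i , j) ∈ F → IsSolution M (suc j , ⌊ suc i /2⌋ , ⌊ suc i /2⌋)
    sound {i , j} a∈ with half {i} {j} (∈⁻ 1 2 a∈)
    ... | k , suc-i≡ = trans (cong (λ h → suc j * suc j + 2 * (h * h)) (trans (cong ⌊_/2⌋ suc-i≡) (⌊2n/2⌋ k)))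
      (*-cancelˡ-≡ _ M 2 (trans (expand (suc j) k) (trans (cong (λ s → 1 * (s * s) + 2 * (suc j * suc j)) (sym suc-i≡)) (trans (∈⁻ 1 2 a∈) (sym 2M≡N)))))
    complete : ∀ {x y} → NonZero x → NonZero y → x ≤ M → y ≤ M → IsSolution M (x , y , y) → (pred (2 * y) , pred x) ∈ F
    complete {x} {y} x≢0 y≢0 x≤M y≤M sol = ∈⁺ 1 2 (m*n≢0 2 y {{_}} {{y≢0}}) x≢0
      -- The doubled variable is at most 2M = N, still within the listed range.
      (≤-trans (*-monoʳ-≤ 2 y≤M) (≤-reflexive 2M≡N)) (≤N x≤M) (trans (sym (expand x y)) (trans (cong (2 *_) sol) 2M≡N))
    inverse : ∀ {(i , j) : ℕ × ℕ} → (i , j) ∈ F → (pred (2 * ⌊ suc i /2⌋) , j) ≡ (i , j)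
    inverse {i , j} a∈ with half {i} {j} (∈⁻ 1 2 a∈)
    ... | k , suc-i≡ = cong (λ n → pred n , j) (trans (cong (2 *_) (trans (cong ⌊_/2⌋ suc-i≡) (⌊2n/2⌋ k))) (sym suc-i≡))

  ā-divisible : ∀ s → 1 ≤ s → 16 ∣ ā s N
  ā-divisible (suc r) _ = Truncation.ā-mod-16 N N≡6 even₁₂ even₂₄ M r refl
    where
    N≡6 : N % 8 ≡ 6
    N≡6 = trans (cong (λ M → (M + M) % 8) (trans (m≡m%n+[m/n]*n M 4) (cong (_+ M / 4 * 4) Pm≡3)))
      (trans (cong (_% 8) (expand (M / 4))) ([m+kn]%n≡m%n 6 (M / 4) 8))
      where
      expand : ∀ w → 3 + w * 4 + (3 + w * 4) ≡ 6 + w * 8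
      expand = solve-∀

-- Powers of p and the conclusion

module _ {p : ℕ} (p-prime : Prime p) where

  private
    instance
      p≢0 : NonZero p
      p≢0 = prime⇒nonZero p-prime

  -- Descent: p divides a, say a = b p, and then b² p = p^(2j). For j = 0 this makes p divide 1;
  -- otherwise b² is the preceding odd power.
  odd-power-nonsquare : ∀ j a → a * a ≢ p ^ suc (2 * j)
  odd-power-nonsquare j a a²≡ with p∣a
    where
    p∣a : p ∣ a
    p∣a with euclidsLemma a a p-prime (subst (p ∣_) (sym a²≡) (m∣m*n (p ^ (2 * j))))
    ... | inj₁ p∣a = p∣a
    ... | inj₂ p∣a = p∣a
  ... | divides b refl = by-cases j b²p≡
    where
    b²p≡ : b * b * p ≡ p ^ (2 * j)
    b²p≡ = *-cancelˡ-≡ (b * b * p) (p ^ (2 * j)) p (trans (regroup p b) a²≡)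
      where
      regroup : ∀ p b → p * (b * b * p) ≡ b * p * (b * p)
      regroup = solve-∀
    by-cases : ∀ j → b * b * p ≢ p ^ (2 * j)
    by-cases zero    eq = nonTrivial⇒≢1 {{prime⇒nonTrivial p-prime}} (∣1⇒≡1 (subst (p ∣_) eq (n∣m*n (b * b))))
    by-cases (suc j) eq = odd-power-nonsquare j b (*-cancelʳ-≡ (b * b) (p ^ suc (2 * j)) p (trans eq (trans (cong (p ^_) (*-suc 2 j)) (*-comm p (p ^ suc (2 * j))))))

  power-coprime : ∀ {m} → ¬ p ∣ m → ∀ c → Coprime (p ^ c) m
  power-coprime {m} p∤m c = Coprimality.sym (coprime-to-power c)
    where
    coprime-to-p : Coprime m p
    coprime-to-p (d∣m , d∣p) with prime⇒irreducible p-prime d∣p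
    ... | inj₁ d≡1  = d≡1
    ... | inj₂ refl = contradiction d∣m p∤m
    coprime-to-power : ∀ c → Coprime m (p ^ c)
    coprime-to-power zero    (_ , d∣1) = ∣1⇒≡1 d∣1
    coprime-to-power (suc c) = coprime-*ʳ coprime-to-p (coprime-to-power c)

power≡1-mod-4 : ∀ {p} → p % 4 ≡ 1 → ∀ c → p ^ c % 4 ≡ 1
power≡1-mod-4 p≡1 zero    = refl
power≡1-mod-4 {p} p≡1 (suc c) = trans (%-distribˡ-* p (p ^ c) 4) (cong₂ (λ a b → a * b % 4) p≡1 (power≡1-mod-4 p≡1 c))

theorem1p11 : (p : ℕ) → Prime p → p % 4 ≡ 1 →
    (s : ℕ) → 1 ≤ s →
    2 ∣ ā s (6 * p) →
    (n k : ℕ) → ¬ (p ∣ 4 * n + 3) →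
    16 ∣ ā s (8 * p ^ (4 * k + 1) * n + 6 * p ^ (4 * k + 1))
theorem1p11 p p-prime p≡1 s 1≤s _ n k p∤m =
  subst (λ N → 16 ∣ ā s N) (index P n) (EvenRepresentations.ā-divisible P m (power-coprime p-prime p∤m c) P-nonsquare (3-mod-4⇒nonsquare m≡3) Pm≡3 s 1≤s)
  where
  c = 4 * k + 1
  P = p ^ c
  m = 4 * n + 3
  -- The index of the theorem is N = 2 P m with P = p^(4k+1) and m = 4n + 3.
  index : ∀ P n → P * (4 * n + 3) + P * (4 * n + 3) ≡ 8 * P * n + 6 * P
  index = solve-∀
  m≡3 : m % 4 ≡ 3
  m≡3 = trans (cong (_% 4) (trans (+-comm (4 * n) 3) (cong (3 +_) (*-comm 4 n)))) ([m+kn]%n≡m%n 3 n 4)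
  Pm≡3 : (P * m) % 4 ≡ 3
  Pm≡3 = trans (%-distribˡ-* P m 4) (cong₂ (λ a b → a * b % 4) (power≡1-mod-4 p≡1 c) m≡3)
  P-nonsquare : ∀ a → a * a ≢ P
  P-nonsquare a a²≡P = odd-power-nonsquare p-prime (2 * k) a (trans a²≡P (cong (p ^_) (odd-exponent k)))
    where
    odd-exponent : ∀ k → 4 * k + 1 ≡ suc (2 * (2 * k))
    odd-exponent = solve-∀
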